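{- $\mathfrak{r}_{1/2}\le\mathfrak{i}_{\mathsf{d}}$.
   Context: Let $\omega=\{0,1,2,\ldots\}$ and identify $n\in\omega$ with $\{0,\ldots,n-1\}$. $\mathcal{D}$ is the family of all $A\subseteq\omega$ for which the asymptotic density $\mathsf{d}(A):=\lim_{n\to\infty}|A\cap n|/n$ exists. For $\mathcal{A}\subseteq\mathcal{P}(\omega)$, $\langle\mathcal{A}\rangle$ denotes the field of subsets of $\omega$ generated by $\mathcal{A}$. A nonempty family $\mathcal{A}\subseteq\mathcal{D}$ is $\mathsf{d}$-independent if: (1) $\mathsf{d}(A)\in(0,1)$ for all $A\in\mathcal{A}$; (2) $\langle\mathcal{A}\rangle\subseteq\mathcal{D}$; (3) $\mathsf{d}(\bigcap\mathcal{F})=\prod_{A\in\mathcal{F}}\mathsf{d}(A)$ for every nonempty finite $\mathcal{F}\subseteq\mathcal{A}$. It is a maximal $\mathsf{d}$-independent family if it is $\mathsf{d}$-independent and not properly contained in another $\mathsf{d}$-independent family. $\mathfrak{i}_{\mathsf{d}}$ denotes the least cardinality of a maximal $\mathsf{d}$-independent family. A family $\mathcal{R}$ of infinite subsets of $\omega$ is $1/2$-reaping if there is no infinite $S\subseteq\omega$ such that $\lim_{n\to\infty}\frac{|S\cap B\cap n|}{|B\cap n|}=\frac12$ for all $B\in\mathcal{R}$. $\mathfrak{r}_{1/2}$ denotes the least cardinality of a $1/2$-reaping family. -}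

module Defs where

open import Level using (Level; 0ℓ; _⊔_) renaming (suc to lsuc)
open import Data.Bool.Base as Bool using (Bool; true; false; not; if_then_else_)
open import Data.Integer.Base using (+_)
open import Data.List.Base using (List; []; foldr)
open import Data.List.Relation.Binary.Pointwise using (Pointwise)
open import Data.List.Relation.Unary.All using (All)
open import Data.List.Relation.Unary.Unique.Setoid using (Unique)
open import Data.Nat.Base as ℕ using (ℕ; zero; suc)
import Data.Nat.Properties as ℕ
open import Data.Product using (Σ; ∃; ∃-syntax; _×_; _,_; proj₁; proj₂)
open import Data.Rational.Base as ℚ using (ℚ; 0ℚ; 1ℚ; ½)
import Data.Rational.Properties as ℚ
open import Data.Rational.Solver using (module +-*-Solver)
open import Data.Sum.Base using (inj₁; inj₂)
open import Function.Base using (_on_)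
open import Function.Bundles using (Func; Injection; Bijection)
open import Relation.Binary.Bundles using (Setoid)
open import Relation.Binary.Construct.On using () renaming (isEquivalence to on-isEquivalence)
open import Relation.Binary.Core using (REL)
open import Relation.Binary.PropositionalEquality
  using (_≡_; _≢_; _≗_; refl; sym; cong; cong₂; subst; _→-setoid_; module ≡-Reasoning)
open import Relation.Nullary using (¬_)
open import Relation.Unary using (Pred; _∈_; _⊆_; _⊂_)

private
  variable
    a b ℓ₁ ℓ₂ r : Level

-- Sets are setoids here, so a choice function has to respect the equality of
-- its domain.  The version for bare types is provable and says nothing about
-- choosing from equivalence classes.

AxiomOfChoice : ∀ a ℓ₁ b ℓ₂ r → Set (lsuc (a ⊔ ℓ₁ ⊔ b ⊔ ℓ₂ ⊔ r))
AxiomOfChoice a ℓ₁ b ℓ₂ r =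
  (A : Setoid a ℓ₁) (B : Setoid b ℓ₂) →
  let module A = Setoid A; module B = Setoid B in
  (R : REL A.Carrier B.Carrier r) →
  (∀ {x x′ y y′} → x A.≈ x′ → y B.≈ y′ → R x y → R x′ y′) →
  (∀ x → ∃[ y ] R x y) →
  Σ (Func A B) λ f → ∀ x → R x (Func.to f x)

IsCauchy : (ℕ → ℚ) → Set
IsCauchy x = ∀ ε → 0ℚ ℚ.< ε →
  ∃[ N ] ∀ m n → N ℕ.≤ m → N ℕ.≤ n → ℚ.∣ x m ℚ.- x n ∣ ℚ.< ε

record ℝ : Set where
  constructor mkℝ
  field
    seq    : ℕ → ℚ
    cauchy : IsCauchy seq

open ℝ public

private
  open +-*-Solver using (solve; _:=_; _:+_; _:*_; :-_; _:-_)

  abstract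
    halve : ∀ ε → ½ ℚ.* ε ℚ.+ ½ ℚ.* ε ≡ ε
    halve ε = begin
      ½ ℚ.* ε ℚ.+ ½ ℚ.* ε ≡⟨ ℚ.*-distribʳ-+ ε ½ ½ ⟨
      (½ ℚ.+ ½) ℚ.* ε     ≡⟨ ℚ.*-identityˡ ε ⟩
      ε                   ∎
      where open ≡-Reasoning

    half-pos : ∀ {ε} → 0ℚ ℚ.< ε → 0ℚ ℚ.< ½ ℚ.* ε
    half-pos {ε} 0<ε = subst (ℚ._< ½ ℚ.* ε) (ℚ.*-zeroʳ ½) (ℚ.*-monoʳ-<-pos ½ 0<ε)

    ∣-∣-swap : ∀ p q → ℚ.∣ p ℚ.- q ∣ ≡ ℚ.∣ q ℚ.- p ∣
    ∣-∣-swap p q = begin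
      ℚ.∣ p ℚ.- q ∣       ≡⟨ cong ℚ.∣_∣ (solve 2 (λ p q → p :- q := :- (q :- p)) refl p q) ⟩
      ℚ.∣ ℚ.- (q ℚ.- p) ∣ ≡⟨ ℚ.∣-p∣≡∣p∣ (q ℚ.- p) ⟩
      ℚ.∣ q ℚ.- p ∣       ∎
      where open ≡-Reasoning

    ∣p∣-∣q∣≤∣p-q∣ : ∀ p q → ℚ.∣ p ∣ ℚ.- ℚ.∣ q ∣ ℚ.≤ ℚ.∣ p ℚ.- q ∣
    ∣p∣-∣q∣≤∣p-q∣ p q = begin
      ℚ.∣ p ∣ ℚ.- ℚ.∣ q ∣
        ≡⟨ cong (λ t → ℚ.∣ t ∣ ℚ.- ℚ.∣ q ∣) (solve 2 (λ p q → p := (p :- q) :+ q) refl p q) ⟩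
      ℚ.∣ (p ℚ.- q) ℚ.+ q ∣ ℚ.- ℚ.∣ q ∣
        ≤⟨ ℚ.+-monoˡ-≤ (ℚ.- ℚ.∣ q ∣) (ℚ.∣p+q∣≤∣p∣+∣q∣ (p ℚ.- q) q) ⟩
      (ℚ.∣ p ℚ.- q ∣ ℚ.+ ℚ.∣ q ∣) ℚ.- ℚ.∣ q ∣
        ≡⟨ solve 2 (λ u v → (u :+ v) :- v := u) refl ℚ.∣ p ℚ.- q ∣ ℚ.∣ q ∣ ⟩
      ℚ.∣ p ℚ.- q ∣ ∎
      where open ℚ.≤-Reasoning

    reverse-triangle : ∀ p q → ℚ.∣ ℚ.∣ p ∣ ℚ.- ℚ.∣ q ∣ ∣ ℚ.≤ ℚ.∣ p ℚ.- q ∣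
    reverse-triangle p q with ℚ.∣p∣≡p∨∣p∣≡-p (ℚ.∣ p ∣ ℚ.- ℚ.∣ q ∣)
    ... | inj₁ eq = subst (ℚ._≤ ℚ.∣ p ℚ.- q ∣) (sym eq) (∣p∣-∣q∣≤∣p-q∣ p q)
    ... | inj₂ eq = begin
      ℚ.∣ ℚ.∣ p ∣ ℚ.- ℚ.∣ q ∣ ∣   ≡⟨ eq ⟩
      ℚ.- (ℚ.∣ p ∣ ℚ.- ℚ.∣ q ∣)
        ≡⟨ solve 2 (λ u v → :- (u :- v) := v :- u) refl ℚ.∣ p ∣ ℚ.∣ q ∣ ⟩
      ℚ.∣ q ∣ ℚ.- ℚ.∣ p ∣         ≤⟨ ∣p∣-∣q∣≤∣p-q∣ q p ⟩
      ℚ.∣ q ℚ.- p ∣               ≡⟨ ∣-∣-swap q p ⟩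
      ℚ.∣ p ℚ.- q ∣               ∎
      where open ℚ.≤-Reasoning

    bounded-by : ∀ p q → ℚ.∣ p ℚ.- q ∣ ℚ.< 1ℚ → ℚ.∣ p ∣ ℚ.≤ 1ℚ ℚ.+ ℚ.∣ q ∣
    bounded-by p q near = begin
      ℚ.∣ p ∣                     ≡⟨ cong ℚ.∣_∣ (solve 2 (λ p q → p := (p :- q) :+ q) refl p q) ⟩
      ℚ.∣ (p ℚ.- q) ℚ.+ q ∣       ≤⟨ ℚ.∣p+q∣≤∣p∣+∣q∣ (p ℚ.- q) q ⟩
      ℚ.∣ p ℚ.- q ∣ ℚ.+ ℚ.∣ q ∣   ≤⟨ ℚ.+-monoˡ-≤ ℚ.∣ q ∣ (ℚ.<⇒≤ near) ⟩
      1ℚ ℚ.+ ℚ.∣ q ∣              ∎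
      where open ℚ.≤-Reasoning

    bound : (x : ℝ) → ∃[ K ] 0ℚ ℚ.< K × ∃[ N ] ∀ n → N ℕ.≤ n → ℚ.∣ seq x n ∣ ℚ.≤ K
    bound x =
      let N , near = cauchy x 1ℚ (ℚ.positive⁻¹ 1ℚ) in
      1ℚ ℚ.+ ℚ.∣ seq x N ∣ ,
      ℚ.+-mono-<-≤ (ℚ.positive⁻¹ 1ℚ) (ℚ.0≤∣p∣ (seq x N)) ,
      N , λ n N≤n → bounded-by (seq x n) (seq x N) (near n N N≤n ℕ.≤-refl)

    shrink : ∀ K ε → 0ℚ ℚ.< K → 0ℚ ℚ.< ε → ∃[ δ ] 0ℚ ℚ.< δ × K ℚ.* δ ≡ ε
    shrink K ε 0<K 0<ε = go {{ℚ.positive 0<K}}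
      where
      go : {{_ : ℚ.Positive K}} → ∃[ δ ] 0ℚ ℚ.< δ × K ℚ.* δ ≡ ε
      go = 1/K ℚ.* ε
         , subst (ℚ._< 1/K ℚ.* ε) (ℚ.*-zeroʳ 1/K)
             (ℚ.*-monoʳ-<-pos 1/K {{ℚ.1/pos⇒pos K}} 0<ε)
         , (begin
             K ℚ.* (1/K ℚ.* ε)  ≡⟨ ℚ.*-assoc K 1/K ε ⟨
             (K ℚ.* 1/K) ℚ.* ε  ≡⟨ cong (ℚ._* ε) (ℚ.*-inverseʳ K {{ℚ.pos⇒nonZero K}}) ⟩
             1ℚ ℚ.* ε           ≡⟨ ℚ.*-identityˡ ε ⟩
             ε                  ∎)
        where
        open ≡-Reasoning
        1/K : ℚ
        1/K = (ℚ.1/ K) {{ℚ.pos⇒nonZero K}}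

    product-bound : ∀ K p d δ → 0ℚ ℚ.< K → ℚ.∣ p ∣ ℚ.≤ K → ℚ.∣ d ∣ ℚ.< δ →
                    ℚ.∣ p ℚ.* d ∣ ℚ.< K ℚ.* δ
    product-bound K p d δ 0<K p≤K d<δ = begin-strict
      ℚ.∣ p ℚ.* d ∣         ≡⟨ ℚ.∣p*q∣≡∣p∣*∣q∣ p d ⟩
      ℚ.∣ p ∣ ℚ.* ℚ.∣ d ∣   ≤⟨ ℚ.*-monoʳ-≤-nonNeg ℚ.∣ d ∣ {{ℚ.∣-∣-nonNeg d}} p≤K ⟩
      K ℚ.* ℚ.∣ d ∣         <⟨ ℚ.*-monoʳ-<-pos K {{ℚ.positive 0<K}} d<δ ⟩
      K ℚ.* δ               ∎
      where open ℚ.≤-Reasoning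

    difference-close : ∀ p q u v ε →
      ℚ.∣ p ℚ.- u ∣ ℚ.< ½ ℚ.* ε → ℚ.∣ q ℚ.- v ∣ ℚ.< ½ ℚ.* ε →
      ℚ.∣ (p ℚ.- q) ℚ.- (u ℚ.- v) ∣ ℚ.< ε
    difference-close p q u v ε h₁ h₂ = begin-strict
      ℚ.∣ (p ℚ.- q) ℚ.- (u ℚ.- v) ∣
        ≡⟨ cong ℚ.∣_∣ (solve 4 (λ p q u v → (p :- q) :- (u :- v) := (p :- u) :- (q :- v))
             refl p q u v) ⟩
      ℚ.∣ (p ℚ.- u) ℚ.- (q ℚ.- v) ∣
        ≤⟨ ℚ.∣p-q∣≤∣p∣+∣q∣ (p ℚ.- u) (q ℚ.- v) ⟩
      ℚ.∣ p ℚ.- u ∣ ℚ.+ ℚ.∣ q ℚ.- v ∣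
        <⟨ ℚ.+-mono-< h₁ h₂ ⟩
      ½ ℚ.* ε ℚ.+ ½ ℚ.* ε
        ≡⟨ halve ε ⟩
      ε ∎
      where open ℚ.≤-Reasoning

    product-diff : ∀ p q u v →
      p ℚ.* q ℚ.- u ℚ.* v ≡ p ℚ.* (q ℚ.- v) ℚ.+ v ℚ.* (p ℚ.- u)
    product-diff = solve 4 (λ p q u v → p :* q :- u :* v := p :* (q :- v) :+ v :* (p :- u)) refl

    product-close : ∀ p q u v ε →
      ℚ.∣ p ℚ.* (q ℚ.- v) ∣ ℚ.< ½ ℚ.* ε → ℚ.∣ v ℚ.* (p ℚ.- u) ∣ ℚ.< ½ ℚ.* ε →
      ℚ.∣ p ℚ.* q ℚ.- u ℚ.* v ∣ ℚ.< ε
    product-close p q u v ε h₁ h₂ = begin-strict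
      ℚ.∣ p ℚ.* q ℚ.- u ℚ.* v ∣
        ≡⟨ cong ℚ.∣_∣ (product-diff p q u v) ⟩
      ℚ.∣ p ℚ.* (q ℚ.- v) ℚ.+ v ℚ.* (p ℚ.- u) ∣
        ≤⟨ ℚ.∣p+q∣≤∣p∣+∣q∣ (p ℚ.* (q ℚ.- v)) (v ℚ.* (p ℚ.- u)) ⟩
      ℚ.∣ p ℚ.* (q ℚ.- v) ∣ ℚ.+ ℚ.∣ v ℚ.* (p ℚ.- u) ∣
        <⟨ ℚ.+-mono-< h₁ h₂ ⟩
      ½ ℚ.* ε ℚ.+ ½ ℚ.* ε
        ≡⟨ halve ε ⟩
      ε ∎
      where open ℚ.≤-Reasoning

fromℚ : ℚ → ℝ
fromℚ q = mkℝ (λ _ → q) is-cauchy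
  where
  abstract
    is-cauchy : IsCauchy (λ _ → q)
    is-cauchy ε 0<ε =
      0 , λ _ _ _ _ → subst (λ t → ℚ.∣ t ∣ ℚ.< ε) (sym (ℚ.+-inverseʳ q)) 0<ε

infixl 7 _*ᵣ_
infixl 6 _-ᵣ_
infix  4 _<ᵣ_

_-ᵣ_ : ℝ → ℝ → ℝ
x -ᵣ y = mkℝ (λ n → seq x n ℚ.- seq y n) is-cauchy
  where
  abstract
    is-cauchy : IsCauchy (λ n → seq x n ℚ.- seq y n)
    is-cauchy ε 0<ε =
      let
        M , hx = cauchy x (½ ℚ.* ε) (half-pos 0<ε)
        N , hy = cauchy y (½ ℚ.* ε) (half-pos 0<ε)
      in
      M ℕ.⊔ N , λ m n m≥ n≥ →
      difference-close (seq x m) (seq y m) (seq x n) (seq y n) ε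
        (hx m n (ℕ.m⊔n≤o⇒m≤o M N m≥) (ℕ.m⊔n≤o⇒m≤o M N n≥))
        (hy m n (ℕ.m⊔n≤o⇒n≤o M N m≥) (ℕ.m⊔n≤o⇒n≤o M N n≥))

_*ᵣ_ : ℝ → ℝ → ℝ
x *ᵣ y = mkℝ (λ n → seq x n ℚ.* seq y n) is-cauchy
  where
  abstract
    is-cauchy : IsCauchy (λ n → seq x n ℚ.* seq y n)
    is-cauchy ε 0<ε =
      let
        K , 0<K , M₁ , x≤K = bound x
        L , 0<L , N₁ , y≤L = bound y
        δ , 0<δ , Kδ≡ = shrink K (½ ℚ.* ε) 0<K (half-pos 0<ε)
        η , 0<η , Lη≡ = shrink L (½ ℚ.* ε) 0<L (half-pos 0<ε)
        N₂ , hy = cauchy y δ 0<δ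
        M₂ , hx = cauchy x η 0<η
      in
      (M₁ ℕ.⊔ N₁) ℕ.⊔ (N₂ ℕ.⊔ M₂) , λ m n m≥ n≥ →
      let
        m≥₁ = ℕ.m⊔n≤o⇒m≤o (M₁ ℕ.⊔ N₁) (N₂ ℕ.⊔ M₂) m≥
        n≥₁ = ℕ.m⊔n≤o⇒m≤o (M₁ ℕ.⊔ N₁) (N₂ ℕ.⊔ M₂) n≥
        m≥₂ = ℕ.m⊔n≤o⇒n≤o (M₁ ℕ.⊔ N₁) (N₂ ℕ.⊔ M₂) m≥
        n≥₂ = ℕ.m⊔n≤o⇒n≤o (M₁ ℕ.⊔ N₁) (N₂ ℕ.⊔ M₂) n≥
      in product-close (seq x m) (seq y m) (seq x n) (seq y n) ε
           (subst (ℚ.∣ seq x m ℚ.* (seq y m ℚ.- seq y n) ∣ ℚ.<_) Kδ≡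
             (product-bound K (seq x m) (seq y m ℚ.- seq y n) δ 0<K
               (x≤K m (ℕ.m⊔n≤o⇒m≤o M₁ N₁ m≥₁))
               (hy m n (ℕ.m⊔n≤o⇒m≤o N₂ M₂ m≥₂) (ℕ.m⊔n≤o⇒m≤o N₂ M₂ n≥₂))))
           (subst (ℚ.∣ seq y n ℚ.* (seq x m ℚ.- seq x n) ∣ ℚ.<_) Lη≡
             (product-bound L (seq y n) (seq x m ℚ.- seq x n) η 0<L
               (y≤L n (ℕ.m⊔n≤o⇒n≤o M₁ N₁ n≥₁))
               (hx m n (ℕ.m⊔n≤o⇒n≤o N₂ M₂ m≥₂) (ℕ.m⊔n≤o⇒n≤o N₂ M₂ n≥₂))))

∣_∣ᵣ : ℝ → ℝ
∣ x ∣ᵣ = mkℝ (λ n → ℚ.∣ seq x n ∣) is-cauchy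
  where
  abstract
    is-cauchy : IsCauchy (λ n → ℚ.∣ seq x n ∣)
    is-cauchy ε 0<ε =
      let N , h = cauchy x ε 0<ε in
      N , λ m n m≥ n≥ → ℚ.≤-<-trans (reverse-triangle (seq x m) (seq x n)) (h m n m≥ n≥)

_<ᵣ_ : ℝ → ℝ → Set
x <ᵣ y = ∃[ ε ] 0ℚ ℚ.< ε × ∃[ N ] ∀ n → N ℕ.≤ n → seq x n ℚ.+ ε ℚ.≤ seq y n

productᵣ : List ℝ → ℝ
productᵣ = foldr _*ᵣ_ (fromℚ 1ℚ)

infix 4 _⟶_

-- A limit is determined only up to equality of reals, that is, up to
-- Cauchy sequences whose difference tends to 0.

_⟶_ : (ℕ → ℚ) → ℝ → Set
s ⟶ x = ∀ ε → fromℚ 0ℚ <ᵣ ε →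
  ∃[ N ] ∀ n → N ℕ.≤ n → ∣ fromℚ (s n) -ᵣ x ∣ᵣ <ᵣ ε

-- Under excluded middle every subset of ω has a characteristic function.
-- Equality of subsets is ≗ throughout, as function extensionality is not
-- available.

𝒫ω : Set
𝒫ω = ℕ → Bool

𝒫ω-setoid : Setoid 0ℓ 0ℓ
𝒫ω-setoid = ℕ →-setoid Bool

ω : 𝒫ω
ω _ = true

infixr 7 _∩_

_∩_ : 𝒫ω → 𝒫ω → 𝒫ω
(A ∩ B) n = A n Bool.∧ B n

∁ : 𝒫ω → 𝒫ω
∁ A n = not (A n)

⋂ : List 𝒫ω → 𝒫ω
⋂ = foldr _∩_ ω

Infinite : 𝒫ω → Set
Infinite A = ∀ m → ∃[ n ] m ℕ.≤ n × A n ≡ true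

-- count A n = |A ∩ n|, where n = {0, …, n-1}.

count : 𝒫ω → ℕ → ℕ
count A zero    = 0
count A (suc n) = (if A n then 1 else 0) ℕ.+ count A n

-- m / 0 is set to 0.  In the limits below a zero denominator occurs only for
-- finitely many terms.

ratio : ℕ → ℕ → ℚ
ratio m zero    = 0ℚ
ratio m (suc n) = + m ℚ./ suc n

HasDensity : 𝒫ω → ℝ → Set
HasDensity A x = (λ n → ratio (count A n) n) ⟶ x

𝒟 : Pred 𝒫ω 0ℓ
𝒟 A = ∃[ x ] HasDensity A x

record Family : Set₁ where
  field
    Mem  : Pred 𝒫ω 0ℓ
    resp : ∀ {A B} → A ≗ B → Mem A → Mem B

open Family public

data ⟨_⟩ (𝒜 : Family) : Pred 𝒫ω 0ℓ where
  gen   : ∀ {A} → A ∈ Mem 𝒜 → A ∈ ⟨ 𝒜 ⟩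
  whole : ω ∈ ⟨ 𝒜 ⟩
  compl : ∀ {A} → A ∈ ⟨ 𝒜 ⟩ → ∁ A ∈ ⟨ 𝒜 ⟩
  inter : ∀ {A B} → A ∈ ⟨ 𝒜 ⟩ → B ∈ ⟨ 𝒜 ⟩ → A ∩ B ∈ ⟨ 𝒜 ⟩
  ext   : ∀ {A B} → A ≗ B → A ∈ ⟨ 𝒜 ⟩ → B ∈ ⟨ 𝒜 ⟩

-- A finite subfamily is a list without repetitions (up to ≗), so that each of
-- its members contributes one factor to the product.

record IsDIndependent (𝒜 : Family) : Set where
  field
    nonempty       : ∃[ A ] A ∈ Mem 𝒜
    ⊆𝒟             : Mem 𝒜 ⊆ 𝒟
    density-in-0-1 : ∀ {A x} → A ∈ Mem 𝒜 → HasDensity A x →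
                     fromℚ 0ℚ <ᵣ x × x <ᵣ fromℚ 1ℚ
    field⊆𝒟        : ⟨ 𝒜 ⟩ ⊆ 𝒟
    independent    : ∀ (F : List 𝒫ω) (xs : List ℝ) →
                     F ≢ [] → All (Mem 𝒜) F → Unique 𝒫ω-setoid F →
                     Pointwise HasDensity F xs →
                     HasDensity (⋂ F) (productᵣ xs)

IsMaximalDIndependent : Family → Set₁
IsMaximalDIndependent 𝒜 =
  IsDIndependent 𝒜 ×
  ¬ (Σ Family λ ℬ → IsDIndependent ℬ × Mem 𝒜 ⊂ Mem ℬ)

record IsHalfReaping (ℛ : Family) : Set where
  field
    all-infinite : ∀ {B} → B ∈ Mem ℛ → Infinite B
    unbisected   : ¬ (∃[ S ] Infinite S ×
                     (∀ {B} → B ∈ Mem ℛ →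
                       (λ n → ratio (count (S ∩ B) n) (count B n)) ⟶ fromℚ ½))

-- A cardinal is represented by any setoid of that size.

∣_∣ : Family → Setoid 0ℓ 0ℓ
∣ 𝒜 ∣ = record
  { Carrier       = ∃ (Mem 𝒜)
  ; _≈_           = _≗_ on proj₁
  ; isEquivalence = on-isEquivalence proj₁ (Setoid.isEquivalence 𝒫ω-setoid)
  }

infix 4 _≤ᶜ_

_≤ᶜ_ : Setoid 0ℓ 0ℓ → Setoid 0ℓ 0ℓ → Set
κ ≤ᶜ μ = Injection κ μ

record IsLeastCardinality (Φ : Family → Set ℓ₁) (κ : Setoid 0ℓ 0ℓ) : Set (lsuc 0ℓ ⊔ ℓ₁) where
  field
    attained : Σ Family λ 𝒜 → Φ 𝒜 × Bijection κ ∣ 𝒜 ∣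
    least    : ∀ 𝒜 → Φ 𝒜 → κ ≤ᶜ ∣ 𝒜 ∣

Is-𝔯½ : Setoid 0ℓ 0ℓ → Set₁
Is-𝔯½ = IsLeastCardinality IsHalfReaping

Is-𝔦d : Setoid 0ℓ 0ℓ → Set₁
Is-𝔦d = IsLeastCardinality IsMaximalDIndependent

{-# OPTIONS --safe #-}
module Submission where

-- Let 𝒜 be a maximal 𝖽-independent family.  If S splits every B ∈ ⟨𝒜⟩ into two parts of density
-- 𝖽(B)/2, then 𝒜 ∪ {S} is again 𝖽-independent: every member of ⟨𝒜 ∪ {S}⟩ is (S ∩ C) ∪ (∁S ∩ D)
-- with C, D ∈ ⟨𝒜⟩, and S ∉ 𝒜 because S does not halve itself.  So there is no such S, and hence
-- the infinite members of ⟨𝒜⟩ form a 1/2-reaping family.  As a finite family is halved by some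
-- set, 𝒜 is infinite.  Every member of ⟨𝒜⟩ is the value of a binary tree of NANDs with leaves in
-- 𝒜, so ∣⟨𝒜⟩∣ ≤ ∣𝒜∣ once the trees over an infinite set K inject into K.
--
-- For the latter, Zorn's lemma gives a maximal injection Tree X → X with X ⊆ K.  If K ∖ X injects
-- into X, then so does K, as X ⊎ X embeds in Tree X.  Otherwise K ∖ X contains a copy of X, onto
-- which the injection can be extended.

open import Defs
open import Level using (Level; 0ℓ)
open import Axiom.ExcludedMiddle using (ExcludedMiddle)
open import Axiom.UniquenessOfIdentityProofs.WithK using (uip)
open import Data.Bool.Base using (Bool; true; false; not; if_then_else_; _∧_)
open import Data.Bool.Properties
  using (∧-identityʳ; ∧-zeroʳ; ∧-idem; if-float; not-involutive; ¬-not)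
open import Data.Empty using (⊥)
open import Data.Integer.Base as ℤ using (+_; +[1+_]; -[1+_])
import Data.Integer.Properties as ℤ
import Data.Integer.Solver as ℤ-Solver
open import Data.List.Base as List using (List; []; _∷_)
open import Data.List.Relation.Binary.Pointwise using (Pointwise; []; _∷_)
open import Data.List.Relation.Unary.All as All using (All; []; _∷_)
open import Data.List.Relation.Unary.AllPairs using ([]; _∷_)
open import Data.List.Relation.Unary.Any using (Any; here; there)
open import Data.List.Relation.Unary.Unique.Setoid using (Unique)
open import Data.Nat.Base as ℕ using (ℕ; zero; suc; z≤n; s≤s)
import Data.Nat.Properties as ℕ
open import Data.Product using (Σ; ∃; ∃-syntax; _×_; _,_; proj₁; proj₂)
open import Data.Rational.Base as ℚ using (ℚ; mkℚ; 0ℚ; 1ℚ; ½)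
import Data.Rational.Properties as ℚ
open import Data.Rational.Solver using (module +-*-Solver)
open import Data.Rational.Unnormalised.Base as ℚᵘ using (mkℚᵘ)
import Data.Rational.Unnormalised.Properties as ℚᵘ
open import Data.Sum.Base as Sum using (_⊎_; inj₁; inj₂; [_,_]′)
open import Data.Sum.Properties using (inj₁-injective; inj₂-injective)
open import Function.Base using (_∘_; id)
open import Function.Bundles using (Func)
open import Function.Construct.Composition using (injection)
open import Function.Definitions using (Injective)
open import Function.Properties.Bijection using (Bijection⇒Inverse)
open import Function.Properties.Inverse using (Inverse⇒Injection) renaming (sym to Inverse-sym)
open import Relation.Binary.Bundles using (Setoid)
open import Relation.Binary.Definitions using (tri<; tri≈; tri>)
open import Relation.Binary.PropositionalEquality hiding (resp)
open import Relation.Nullary using (¬_; Dec; does; yes; no; contradiction)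
open import Relation.Nullary.Decidable using (dec-true; toSum)
open import Relation.Unary using (_∈_; _∉_; _⊆_)

-- Sequences of rationals whose difference tends to 0

half-pos : ∀ {ε} → 0ℚ ℚ.< ε → 0ℚ ℚ.< ½ ℚ.* ε
half-pos {ε} 0<ε = subst (ℚ._< ½ ℚ.* ε) (ℚ.*-zeroʳ ½) (ℚ.*-monoʳ-<-pos ½ 0<ε)

half+half : ∀ ε → ½ ℚ.* ε ℚ.+ ½ ℚ.* ε ≡ ε
half+half ε = trans (sym (ℚ.*-distribʳ-+ ε ½ ½)) (ℚ.*-identityˡ ε)

∣p-q∣≡∣q-p∣ : ∀ p q → ℚ.∣ p ℚ.- q ∣ ≡ ℚ.∣ q ℚ.- p ∣
∣p-q∣≡∣q-p∣ p q = trans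
  (cong ℚ.∣_∣ (solve 2 (λ p q → p :- q := :- (q :- p)) refl p q)) (ℚ.∣-p∣≡∣p∣ (q ℚ.- p))
  where open +-*-Solver

∣p-r∣≤∣p-q∣+∣q-r∣ : ∀ p q r → ℚ.∣ p ℚ.- r ∣ ℚ.≤ ℚ.∣ p ℚ.- q ∣ ℚ.+ ℚ.∣ q ℚ.- r ∣
∣p-r∣≤∣p-q∣+∣q-r∣ p q r = subst (λ t → ℚ.∣ t ∣ ℚ.≤ ℚ.∣ p ℚ.- q ∣ ℚ.+ ℚ.∣ q ℚ.- r ∣)
  (solve 3 (λ p q r → (p :- q) :+ (q :- r) := p :- r) refl p q r)
  (ℚ.∣p+q∣≤∣p∣+∣q∣ (p ℚ.- q) (q ℚ.- r))
  where open +-*-Solver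

∣p-q∣≤r : ∀ {p q r} → p ℚ.≤ r ℚ.+ q → q ℚ.≤ r ℚ.+ p → ℚ.∣ p ℚ.- q ∣ ℚ.≤ r
∣p-q∣≤r {p} {q} {r} h k with ℚ.∣p∣≡p∨∣p∣≡-p (p ℚ.- q)
... | inj₁ eq = subst₂ ℚ._≤_ (sym eq) (solve 2 (λ r q → (r :+ q) :- q := r) refl r q)
                  (ℚ.+-monoˡ-≤ (ℚ.- q) h)
  where open +-*-Solver
... | inj₂ eq = subst₂ ℚ._≤_
                  (sym (trans eq (solve 2 (λ p q → :- (p :- q) := q :- p) refl p q)))
                  (solve 2 (λ r p → (r :+ p) :- p := r) refl r p)
                  (ℚ.+-monoˡ-≤ (ℚ.- p) k)
  where open +-*-Solver

infix 4 _~_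

-- Limits are handled through this relation between rational sequences: tolerances are rational, and
-- the right-hand side may vary with n where no limit has a name. A record, so that both sequences
-- can be inferred from a proof.
record _~_ (s t : ℕ → ℚ) : Set where
  field
    close : ∀ ε → 0ℚ ℚ.< ε → ∃[ N ] ∀ n → N ℕ.≤ n → ℚ.∣ s n ℚ.- t n ∣ ℚ.< ε

open _~_

≗⇒~ : ∀ {s t} → s ≗ t → s ~ t
close (≗⇒~ {s} {t} s≗t) ε 0<ε = 0 , λ n _ → subst (λ d → ℚ.∣ d ∣ ℚ.< ε)
  (sym (trans (cong (ℚ._- t n) (s≗t n)) (ℚ.+-inverseʳ (t n)))) 0<ε

~-sym : ∀ {s t} → s ~ t → t ~ s
close (~-sym {s} {t} h) ε 0<ε =
  let N , near = close h ε 0<ε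
  in N , λ n N≤n → subst (ℚ._< ε) (∣p-q∣≡∣q-p∣ (s n) (t n)) (near n N≤n)

~-trans : ∀ {s t u} → s ~ t → t ~ u → s ~ u
close (~-trans {s} {t} {u} h k) ε 0<ε =
  let M , near₁ = close h (½ ℚ.* ε) (half-pos 0<ε)
      N , near₂ = close k (½ ℚ.* ε) (half-pos 0<ε)
  in M ℕ.⊔ N , λ n ≥n → ℚ.≤-<-trans (∣p-r∣≤∣p-q∣+∣q-r∣ (s n) (t n) (u n))
       (subst (_ ℚ.<_) (half+half ε)
         (ℚ.+-mono-< (near₁ n (ℕ.m⊔n≤o⇒m≤o M N ≥n)) (near₂ n (ℕ.m⊔n≤o⇒n≤o M N ≥n))))

~-+ : ∀ {s s′ t t′} → s ~ s′ → t ~ t′ → (λ n → s n ℚ.+ t n) ~ (λ n → s′ n ℚ.+ t′ n)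
close (~-+ {s} {s′} {t} {t′} h k) ε 0<ε =
  let M , near₁ = close h (½ ℚ.* ε) (half-pos 0<ε)
      N , near₂ = close k (½ ℚ.* ε) (half-pos 0<ε)
  in M ℕ.⊔ N , λ n ≥n → ℚ.≤-<-trans
       (subst (λ d → ℚ.∣ d ∣ ℚ.≤ ℚ.∣ s n ℚ.- s′ n ∣ ℚ.+ ℚ.∣ t n ℚ.- t′ n ∣)
         (solve 4 (λ s s′ t t′ → (s :- s′) :+ (t :- t′) := (s :+ t) :- (s′ :+ t′)) refl
           (s n) (s′ n) (t n) (t′ n))
         (ℚ.∣p+q∣≤∣p∣+∣q∣ (s n ℚ.- s′ n) (t n ℚ.- t′ n)))
       (subst (_ ℚ.<_) (half+half ε)
         (ℚ.+-mono-< (near₁ n (ℕ.m⊔n≤o⇒m≤o M N ≥n)) (near₂ n (ℕ.m⊔n≤o⇒n≤o M N ≥n))))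
  where open +-*-Solver

EventuallyBounded : (ℕ → ℚ) → Set
EventuallyBounded u = ∃[ K ] ℚ.Positive K × ∃[ N ] ∀ n → N ℕ.≤ n → ℚ.∣ u n ∣ ℚ.≤ K

-- Once |u n| ≤ K, a gap below ε / K between s and t becomes a gap below ε.
~-*ˡ : ∀ {u s t} → EventuallyBounded u → s ~ t → (λ n → u n ℚ.* s n) ~ (λ n → u n ℚ.* t n)
close (~-*ˡ {u} {s} {t} (K , K>0 , M , bounded) h) ε 0<ε =
  let N , near = close h δ 0<δ
  in M ℕ.⊔ N , λ n ≥n → begin-strict
       ℚ.∣ u n ℚ.* s n ℚ.- u n ℚ.* t n ∣
         ≡⟨ cong ℚ.∣_∣ (solve 3 (λ u s t → u :* s :- u :* t := u :* (s :- t)) refl (u n) (s n) (t n)) ⟩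
       ℚ.∣ u n ℚ.* (s n ℚ.- t n) ∣
         ≡⟨ ℚ.∣p*q∣≡∣p∣*∣q∣ (u n) (s n ℚ.- t n) ⟩
       ℚ.∣ u n ∣ ℚ.* ℚ.∣ s n ℚ.- t n ∣
         ≤⟨ ℚ.*-monoʳ-≤-nonNeg ℚ.∣ s n ℚ.- t n ∣ {{ℚ.∣-∣-nonNeg (s n ℚ.- t n)}}
              (bounded n (ℕ.m⊔n≤o⇒m≤o M N ≥n)) ⟩
       K ℚ.* ℚ.∣ s n ℚ.- t n ∣
         <⟨ ℚ.*-monoʳ-<-pos K (near n (ℕ.m⊔n≤o⇒n≤o M N ≥n)) ⟩
       K ℚ.* δ
         ≡⟨ ℚ.*-assoc K 1/K ε ⟨
       (K ℚ.* 1/K) ℚ.* ε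
         ≡⟨ cong (ℚ._* ε) (ℚ.*-inverseʳ K) ⟩
       1ℚ ℚ.* ε
         ≡⟨ ℚ.*-identityˡ ε ⟩
       ε ∎
  where
  open ℚ.≤-Reasoning
  open +-*-Solver using (solve; _:=_; _:*_; _:-_)
  instance
    _ = K>0
    _ = ℚ.pos⇒nonZero K
  1/K = ℚ.1/ K
  instance _ = ℚ.1/pos⇒pos K
  δ = 1/K ℚ.* ε
  0<δ : 0ℚ ℚ.< δ
  0<δ = subst (ℚ._< δ) (ℚ.*-zeroʳ 1/K) (ℚ.*-monoʳ-<-pos 1/K 0<ε)

~-½ : ∀ {s t} → s ~ t → (λ n → ½ ℚ.* s n) ~ (λ n → ½ ℚ.* t n)
~-½ = ~-*ˡ (½ , _ , 0 , λ _ _ → ℚ.≤-refl)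

cauchy⇒bounded : (x : ℝ) → EventuallyBounded (seq x)
cauchy⇒bounded x =
  let N , near = cauchy x 1ℚ (ℚ.positive⁻¹ 1ℚ)
  in 1ℚ ℚ.+ ℚ.∣ seq x N ∣
   , ℚ.positive (ℚ.+-mono-<-≤ (ℚ.positive⁻¹ 1ℚ) (ℚ.0≤∣p∣ (seq x N)))
   , N , λ n N≤n → begin
       ℚ.∣ seq x n ∣
         ≡⟨ cong ℚ.∣_∣ (solve 2 (λ p q → p := (p :- q) :+ q) refl (seq x n) (seq x N)) ⟩
       ℚ.∣ (seq x n ℚ.- seq x N) ℚ.+ seq x N ∣
         ≤⟨ ℚ.∣p+q∣≤∣p∣+∣q∣ (seq x n ℚ.- seq x N) (seq x N) ⟩
       ℚ.∣ seq x n ℚ.- seq x N ∣ ℚ.+ ℚ.∣ seq x N ∣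
         ≤⟨ ℚ.+-monoˡ-≤ ℚ.∣ seq x N ∣ (ℚ.<⇒≤ (near n N N≤n ℕ.≤-refl)) ⟩
       1ℚ ℚ.+ ℚ.∣ seq x N ∣ ∎
  where
  open ℚ.≤-Reasoning
  open +-*-Solver using (solve; _:=_; _:+_; _:-_)

-- The hypothesis bounds the distance from s n to late terms of x, so such a term, of index m, is
-- put between s n and `seq x n`; each of the two gaps is below ½ε.
⟶⇒~ : ∀ s x → s ⟶ x → s ~ seq x
close (⟶⇒~ s x s⟶x) ε 0<ε =
  let ½ε = ½ ℚ.* ε
      N₁ , near = s⟶x (fromℚ ½ε) (½ε , half-pos 0<ε , 0 , λ _ _ → ℚ.≤-reflexive (ℚ.+-identityˡ ½ε))
      N₂ , near′ = cauchy x ½ε (half-pos 0<ε)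
  in N₁ ℕ.⊔ N₂ , λ n ≥n →
    let δ , 0<δ , M , h = near n (ℕ.m⊔n≤o⇒m≤o N₁ N₂ ≥n)
        m = M ℕ.⊔ N₂
        d = ℚ.∣ s n ℚ.- seq x m ∣
    in ℚ.≤-<-trans (∣p-r∣≤∣p-q∣+∣q-r∣ (s n) (seq x m) (seq x n))
         (subst (d ℚ.+ ℚ.∣ seq x m ℚ.- seq x n ∣ ℚ.<_) (half+half ε)
           (ℚ.+-mono-<
             (ℚ.<-≤-trans (subst (ℚ._< d ℚ.+ δ) (ℚ.+-identityʳ d) (ℚ.+-monoʳ-< d 0<δ))
               (h m (ℕ.m≤m⊔n M N₂)))
             (near′ m n (ℕ.m≤n⊔m M N₂) (ℕ.m⊔n≤o⇒n≤o N₁ N₂ ≥n))))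

-- A rational e > 0 bounds the late terms of ε from below. Two quarters of e pay for the way from s
-- n over `seq x n` to `seq x m`, and the remaining ½e is the margin in the definition of `_<ᵣ_`.
~⇒⟶ : ∀ {s} x → s ~ seq x → s ⟶ x
~⇒⟶ {s} x s~x ε (e , 0<e , N₀ , e≤ε) =
  let ½e = ½ ℚ.* e
      ¼e = ½ ℚ.* ½e
      0<¼e = half-pos (half-pos 0<e)
      N₁ , near = close s~x ¼e 0<¼e
      N₂ , near′ = cauchy x ¼e 0<¼e
  in N₁ ℕ.⊔ N₂ , λ n ≥n → ½e , half-pos 0<e , N₀ ℕ.⊔ N₂ , λ m ≥m → begin
       ℚ.∣ s n ℚ.- seq x m ∣ ℚ.+ ½e
         ≤⟨ ℚ.+-monoˡ-≤ ½e (∣p-r∣≤∣p-q∣+∣q-r∣ (s n) (seq x n) (seq x m)) ⟩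
       (ℚ.∣ s n ℚ.- seq x n ∣ ℚ.+ ℚ.∣ seq x n ℚ.- seq x m ∣) ℚ.+ ½e
         ≤⟨ ℚ.+-monoˡ-≤ ½e (ℚ.<⇒≤ (ℚ.+-mono-< (near n (ℕ.m⊔n≤o⇒m≤o N₁ N₂ ≥n))
              (near′ n m (ℕ.m⊔n≤o⇒n≤o N₁ N₂ ≥n) (ℕ.m⊔n≤o⇒n≤o N₀ N₂ ≥m)))) ⟩
       (¼e ℚ.+ ¼e) ℚ.+ ½e
         ≡⟨ trans (cong (ℚ._+ ½e) (half+half ½e)) (half+half e) ⟩
       e
         ≡⟨ ℚ.+-identityˡ e ⟨
       0ℚ ℚ.+ e
         ≤⟨ e≤ε m (ℕ.m⊔n≤o⇒m≤o N₀ N₂ ≥m) ⟩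
       seq ε m ∎
  where open ℚ.≤-Reasoning

p≤∣p∣ : ∀ p → p ℚ.≤ ℚ.∣ p ∣
p≤∣p∣ p with ℚ.≤-total 0ℚ p
... | inj₁ 0≤p = ℚ.≤-reflexive (sym (ℚ.0≤p⇒∣p∣≡p 0≤p))
... | inj₂ p≤0 = ℚ.≤-trans p≤0 (ℚ.0≤∣p∣ p)

p≤∣p-q∣+q : ∀ p q → p ℚ.≤ ℚ.∣ p ℚ.- q ∣ ℚ.+ q
p≤∣p-q∣+q p q = subst (ℚ._≤ ℚ.∣ p ℚ.- q ∣ ℚ.+ q) (solve 2 (λ p q → (p :- q) :+ q := p) refl p q)
  (ℚ.+-monoˡ-≤ q (p≤∣p∣ (p ℚ.- q)))
  where open +-*-Solver

-- Within ¼ of ½ the sequence stays in [¼, ¾], which leaves the margin ¼ on both sides.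
~½⇒in-0-1 : ∀ x → seq x ~ (λ _ → ½) → fromℚ 0ℚ <ᵣ x × x <ᵣ fromℚ 1ℚ
~½⇒in-0-1 x x~½ =
  let N , near = close x~½ ¼ (ℚ.positive⁻¹ ¼)
  in (¼ , ℚ.positive⁻¹ ¼ , N , λ n N≤n → 0+¼≤ (seq x n) (ℚ.<⇒≤ (near n N≤n)))
   , (¼ , ℚ.positive⁻¹ ¼ , N , λ n N≤n → +¼≤1 (seq x n) (ℚ.<⇒≤ (near n N≤n)))
  where
  open ℚ.≤-Reasoning
  ¼ = ½ ℚ.* ½
  0+¼≤ : ∀ p → ℚ.∣ p ℚ.- ½ ∣ ℚ.≤ ¼ → 0ℚ ℚ.+ ¼ ℚ.≤ p
  0+¼≤ p h = subst (¼ ℚ.≤_) (trans (ℚ.+-comm (ℚ.- ¼) (¼ ℚ.+ p)) (solve 1 (λ p → (con ¼ :+ p) :- con ¼ := p) refl p))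
    (ℚ.+-monoʳ-≤ (ℚ.- ¼) (ℚ.≤-trans (p≤∣p-q∣+q ½ p)
      (ℚ.+-monoˡ-≤ p (subst (ℚ._≤ ¼) (∣p-q∣≡∣q-p∣ p ½) h))))
    where open +-*-Solver
  +¼≤1 : ∀ p → ℚ.∣ p ℚ.- ½ ∣ ℚ.≤ ¼ → p ℚ.+ ¼ ℚ.≤ 1ℚ
  +¼≤1 p h = ℚ.+-monoˡ-≤ ¼ (ℚ.≤-trans (p≤∣p-q∣+q p ½) (ℚ.+-monoˡ-≤ ½ h))

-- Fractions with natural numerator and denominator

-- Unnormalised fractions show numerator and denominator, so identities of ratios reduce to
-- polynomial identities over ℤ.
toℚᵘ-ratio : ∀ m n → ℚ.toℚᵘ (ratio m (suc n)) ℚᵘ.≃ mkℚᵘ (+ m) n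
toℚᵘ-ratio m n = ℚ.toℚᵘ-fromℚᵘ (mkℚᵘ (+ m) n)

ratio-zero : ∀ n → ratio 0 n ≡ 0ℚ
ratio-zero zero    = refl
ratio-zero (suc n) = ℚ.toℚᵘ-injective (ℚᵘ.≃-trans (toℚᵘ-ratio 0 n) (ℚᵘ.*≡* refl))

ratio-self : ∀ n → ratio (suc n) (suc n) ≡ 1ℚ
ratio-self n = ℚ.toℚᵘ-injective
  (ℚᵘ.≃-trans (toℚᵘ-ratio (suc n) n) (ℚᵘ.*≡* (ℤ.*-comm (+ suc n) (+ 1))))

ratio-+ : ∀ l m n → ratio (l ℕ.+ m) n ≡ ratio l n ℚ.+ ratio m n
ratio-+ l m zero    = refl
ratio-+ l m (suc n) = ℚ.toℚᵘ-injective (begin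
  ℚ.toℚᵘ (ratio (l ℕ.+ m) (suc n))
    ≈⟨ toℚᵘ-ratio (l ℕ.+ m) n ⟩
  mkℚᵘ (+ (l ℕ.+ m)) n
    ≈⟨ ℚᵘ.*≡* (solve 3 (λ l m d → (l :+ m) :* (d :* d) := (l :* d :+ m :* d) :* d) refl
         (+ l) (+ m) (+ suc n)) ⟩
  mkℚᵘ (+ l) n ℚᵘ.+ mkℚᵘ (+ m) n
    ≈⟨ ℚᵘ.+-cong (toℚᵘ-ratio l n) (toℚᵘ-ratio m n) ⟨
  ℚ.toℚᵘ (ratio l (suc n)) ℚᵘ.+ ℚ.toℚᵘ (ratio m (suc n))
    ≈⟨ ℚ.toℚᵘ-homo-+ (ratio l (suc n)) (ratio m (suc n)) ⟨
  ℚ.toℚᵘ (ratio l (suc n) ℚ.+ ratio m (suc n)) ∎)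
  where
  open ℚᵘ.≃-Reasoning
  open ℤ-Solver.+-*-Solver using (solve; _:=_; _:+_; _:*_)

ratio-* : ∀ l m n → ratio l (suc m) ℚ.* ratio (suc m) (suc n) ≡ ratio l (suc n)
ratio-* l m n = ℚ.toℚᵘ-injective (begin
  ℚ.toℚᵘ (ratio l (suc m) ℚ.* ratio (suc m) (suc n))
    ≈⟨ ℚ.toℚᵘ-homo-* (ratio l (suc m)) (ratio (suc m) (suc n)) ⟩
  ℚ.toℚᵘ (ratio l (suc m)) ℚᵘ.* ℚ.toℚᵘ (ratio (suc m) (suc n))
    ≈⟨ ℚᵘ.*-cong (toℚᵘ-ratio l m) (toℚᵘ-ratio (suc m) n) ⟩
  mkℚᵘ (+ l) m ℚᵘ.* mkℚᵘ (+ suc m) n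
    ≈⟨ ℚᵘ.*≡* (solve 3 (λ l m n → (l :* m) :* n := l :* (m :* n)) refl
         (+ l) (+ suc m) (+ suc n)) ⟩
  mkℚᵘ (+ l) n
    ≈⟨ toℚᵘ-ratio l n ⟨
  ℚ.toℚᵘ (ratio l (suc n)) ∎)
  where
  open ℚᵘ.≃-Reasoning
  open ℤ-Solver.+-*-Solver using (solve; _:=_; _:*_)

ratio-mono-≤ : ∀ {l m} n → l ℕ.≤ m → ratio l n ℚ.≤ ratio m n
ratio-mono-≤ zero _ = ℚ.≤-refl
ratio-mono-≤ {l} {m} (suc n) l≤m = ℚ.toℚᵘ-cancel-≤
  (ℚᵘ.≤-respʳ-≃ (ℚᵘ.≃-sym (toℚᵘ-ratio m n)) (ℚᵘ.≤-respˡ-≃ (ℚᵘ.≃-sym (toℚᵘ-ratio l n))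
    (ℚᵘ.*≤* (ℤ.*-monoʳ-≤-nonNeg (+ suc n) (ℤ.+≤+ l≤m)))))

0≤ratio : ∀ m n → 0ℚ ℚ.≤ ratio m n
0≤ratio m n = subst (ℚ._≤ ratio m n) (ratio-zero n) (ratio-mono-≤ n z≤n)

-- Writing ε = (p + 1) / (q + 1), every n > m(q + 1) satisfies m / n < 1 / (q + 1) ≤ ε.
ratio-null : ∀ m → (λ n → ratio m n) ~ (λ _ → 0ℚ)
close (ratio-null m) ε@(mkℚ +[1+ p ] q _) 0<ε = suc (m ℕ.* suc q) , λ where
  (suc n) (s≤s mq≤n) → subst (ℚ._< ε)
    (trans (sym (ℚ.0≤p⇒∣p∣≡p (0≤ratio m (suc n)))) (cong ℚ.∣_∣ (sym (ℚ.+-identityʳ (ratio m (suc n))))))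
    (ℚ.toℚᵘ-cancel-< (ℚᵘ.<-respˡ-≃ (ℚᵘ.≃-sym (toℚᵘ-ratio m n))
      (ℚᵘ.*<* (subst₂ ℤ._<_ (ℤ.pos-* m (suc q)) (ℤ.pos-* (suc p) (suc n))
        (ℤ.+<+ (ℕ.<-≤-trans (s≤s mq≤n) (ℕ.m≤n*m (suc n) (suc p))))))))
close (ratio-null m) (mkℚ (+ 0) q _) (ℚ.*<* (ℤ.+<+ ()))
close (ratio-null m) (mkℚ -[1+ _ ] q _) (ℚ.*<* ())

ratio-close : ∀ m {s t} → (∀ n → ℚ.∣ s n ℚ.- t n ∣ ℚ.≤ ratio m n) → s ~ t
close (ratio-close m bounded) ε 0<ε =
  let N , small = close (ratio-null m) ε 0<ε
  in N , λ n N≤n → ℚ.≤-<-trans (bounded n) (ℚ.≤-<-trans (p≤∣p∣ (ratio m n))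
       (subst (λ p → ℚ.∣ p ∣ ℚ.< ε) (ℚ.+-identityʳ (ratio m n)) (small n N≤n)))

-- Density

dens : 𝒫ω → ℕ → ℚ
dens A n = ratio (count A n) n

count-cong : ∀ {A B} → A ≗ B → count A ≗ count B
count-cong A≗B zero = refl
count-cong A≗B (suc n) = cong₂ (λ b k → (if b then 1 else 0) ℕ.+ k) (A≗B n) (count-cong A≗B n)

count-split : ∀ A B n → count B n ≡ count (A ∩ B) n ℕ.+ count (∁ A ∩ B) n
count-split A B zero = refl
count-split A B (suc n) with A n | B n
... | true  | true  = cong suc (count-split A B n)
... | true  | false = count-split A B n
... | false | true  = trans (cong suc (count-split A B n)) (sym (ℕ.+-suc _ _))
... | false | false = count-split A B n

count-∩-≤ : ∀ A B n → count (A ∩ B) n ℕ.≤ count B n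
count-∩-≤ A B n = subst (count (A ∩ B) n ℕ.≤_) (sym (count-split A B n)) (ℕ.m≤m+n _ _)

count-ω : ∀ n → count ω n ≡ n
count-ω zero    = refl
count-ω (suc n) = cong suc (count-ω n)

∩-ω : ∀ A → A ∩ ω ≗ A
∩-ω A n = ∧-identityʳ (A n)

count-≤ : ∀ A n → count A n ℕ.≤ n
count-≤ A n = subst₂ ℕ._≤_ (count-cong (∩-ω A) n) (count-ω n) (count-∩-≤ A ω n)

count-finite : ∀ {A m} → (∀ n → m ℕ.≤ n → A n ≡ false) → ∀ n → count A n ℕ.≤ m
count-finite         h zero    = z≤n
count-finite {A} {m} h (suc n) with m ℕ.≤? n
... | yes m≤n rewrite h n m≤n = count-finite h n
... | no  m≰n = ℕ.≤-trans (count-≤ A (suc n)) (ℕ.≰⇒> m≰n)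

∧-swap : ∀ a b c → a ∧ b ∧ c ≡ b ∧ a ∧ c
∧-swap true  b     c = refl
∧-swap false true  c = refl
∧-swap false false c = refl

dens-cong : ∀ {A B} → A ≗ B → dens A ≗ dens B
dens-cong A≗B n = cong (λ k → ratio k n) (count-cong A≗B n)

dens-split : ∀ A B n → dens B n ≡ dens (A ∩ B) n ℚ.+ dens (∁ A ∩ B) n
dens-split A B n =
  trans (cong (λ k → ratio k n) (count-split A B n)) (ratio-+ _ _ n)

dens-ω : dens ω ~ λ _ → 1ℚ
close dens-ω ε 0<ε = 1 , λ where
  (suc n) _ → subst (λ p → ℚ.∣ p ℚ.- 1ℚ ∣ ℚ.< ε)
    (sym (trans (cong (λ k → ratio k (suc n)) (count-ω (suc n))) (ratio-self n))) 0<ε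

dens-finite : ∀ {A m} → (∀ n → m ℕ.≤ n → A n ≡ false) → dens A ~ λ _ → 0ℚ
dens-finite {A} {m} h = ratio-close m λ n → subst (ℚ._≤ ratio m n)
  (trans (sym (ℚ.0≤p⇒∣p∣≡p (0≤ratio (count A n) n))) (cong ℚ.∣_∣ (sym (ℚ.+-identityʳ (dens A n)))))
  (ratio-mono-≤ n (count-finite h n))

-- Sets that halve other sets

-- Measured against n instead of |B ∩ n|: the condition is then additive over disjoint pieces of B,
-- holds for every finite B, and makes sense when B has no density.
record HalfOn (S B : 𝒫ω) : Set where
  field
    half : dens (S ∩ B) ~ λ n → ½ ℚ.* dens B n

open HalfOn

halfOn-cong : ∀ {S S′ B B′} → S ∩ B ≗ S′ ∩ B′ → B ≗ B′ → HalfOn S′ B′ → HalfOn S B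
half (halfOn-cong S∩B≗ B≗ h) = ~-trans (≗⇒~ (dens-cong S∩B≗))
  (~-trans (half h) (≗⇒~ λ n → cong (½ ℚ.*_) (sym (dens-cong B≗ n))))

halfOn-resp : ∀ {S B B′} → B ≗ B′ → HalfOn S B → HalfOn S B′
halfOn-resp {S} B≗B′ =
  halfOn-cong (λ n → cong (S n ∧_) (sym (B≗B′ n))) (λ n → sym (B≗B′ n))

-- The densities of S ∩ B and of B are both sums over the pieces of B inside and outside A.
halfOn-split : ∀ A {S B} → HalfOn S (A ∩ B) → HalfOn S (∁ A ∩ B) → HalfOn S B
half (halfOn-split A {S} {B} h k) =
  ~-trans (≗⇒~ left) (~-trans (~-+ (half h) (half k)) (≗⇒~ right))
  where
  left : ∀ n → dens (S ∩ B) n ≡ dens (S ∩ A ∩ B) n ℚ.+ dens (S ∩ ∁ A ∩ B) n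
  left n = trans (dens-split A (S ∩ B) n)
    (cong₂ ℚ._+_ (dens-cong (λ m → ∧-swap (A m) (S m) (B m)) n)
                 (dens-cong (λ m → ∧-swap (not (A m)) (S m) (B m)) n))
  right : ∀ n → ½ ℚ.* dens (A ∩ B) n ℚ.+ ½ ℚ.* dens (∁ A ∩ B) n ≡ ½ ℚ.* dens B n
  right n = trans (sym (ℚ.*-distribˡ-+ ½ (dens (A ∩ B) n) (dens (∁ A ∩ B) n)))
    (cong (½ ℚ.*_) (sym (dens-split A B n)))

-- The parts of B inside and outside S deviate from half of B by opposite amounts.
halfOn-∁ : ∀ {S B} → HalfOn S B → HalfOn (∁ S) B
close (half (halfOn-∁ {S} {B} h)) ε 0<ε =
  let N , near = close (half h) ε 0<ε
  in N , λ n N≤n → subst (ℚ._< ε) (eq n) (near n N≤n)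
  where
  open +-*-Solver
  eq : ∀ n → ℚ.∣ dens (S ∩ B) n ℚ.- ½ ℚ.* dens B n ∣ ≡ ℚ.∣ dens (∁ S ∩ B) n ℚ.- ½ ℚ.* dens B n ∣
  eq n rewrite dens-split S B n = trans
    (cong ℚ.∣_∣ (solve 2 (λ u v → u :- con ½ :* (u :+ v) := con ½ :* (u :+ v) :- v) refl
      (dens (S ∩ B) n) (dens (∁ S ∩ B) n)))
    (∣p-q∣≡∣q-p∣ (½ ℚ.* (dens (S ∩ B) n ℚ.+ dens (∁ S ∩ B) n)) (dens (∁ S ∩ B) n))

-- A bounded discrepancy between 2|S ∩ B ∩ n| and |B ∩ n| vanishes on division by n.
halfOn-balanced : ∀ m {S B} →
  (∀ n → count (S ∩ B) n ℕ.+ count (S ∩ B) n ℕ.≤ m ℕ.+ count B n) →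
  (∀ n → count B n ℕ.≤ m ℕ.+ (count (S ∩ B) n ℕ.+ count (S ∩ B) n)) →
  HalfOn S B
half (halfOn-balanced m {S} {B} h k) = ~-trans (≗⇒~ halve) (~-½ double)
  where
  halve : ∀ n → dens (S ∩ B) n ≡ ½ ℚ.* (dens (S ∩ B) n ℚ.+ dens (S ∩ B) n)
  halve n = sym (trans (ℚ.*-distribˡ-+ ½ (dens (S ∩ B) n) (dens (S ∩ B) n))
    (half+half (dens (S ∩ B) n)))
  double : (λ n → dens (S ∩ B) n ℚ.+ dens (S ∩ B) n) ~ dens B
  double = ratio-close m λ n →
    let c = count (S ∩ B) n
    in ∣p-q∣≤r
      (subst₂ ℚ._≤_ (ratio-+ c c n) (ratio-+ m (count B n) n) (ratio-mono-≤ n (h n)))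
      (subst (dens B n ℚ.≤_)
        (trans (ratio-+ m (c ℕ.+ c) n) (cong (ratio m n ℚ.+_) (ratio-+ c c n)))
        (ratio-mono-≤ n (k n)))

halfOn-finite : ∀ {S B m} → (∀ n → m ℕ.≤ n → B n ≡ false) → HalfOn S B
half (halfOn-finite {S} h) = ~-trans
  (dens-finite λ n m≤n → trans (cong (S n ∧_) (h n m≤n)) (∧-zeroʳ (S n)))
  (~-sym (~-½ (dens-finite h)))

-- l/n - ½(m/n) = (l/m - ½)(m/n), and m/n ≤ 1. This carries bisection relative to B over to
-- `HalfOn`.
ratio-halves : ∀ {l m n} → l ℕ.≤ m → m ℕ.≤ n →
  ℚ.∣ ratio l n ℚ.- ½ ℚ.* ratio m n ∣ ℚ.≤ ℚ.∣ ratio l m ℚ.- ½ ∣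
-- Here l = m = 0, and the convention for a zero denominator makes the right-hand side ½.
ratio-halves {n = n} z≤n z≤n rewrite ratio-zero n = ℚ.0≤∣p∣ (0ℚ ℚ.- ½)
ratio-halves {l} {suc m} {suc n} l≤m m≤n = begin
  ℚ.∣ ratio l (suc n) ℚ.- ½ ℚ.* r ∣
    ≡⟨ cong (λ p → ℚ.∣ p ℚ.- ½ ℚ.* r ∣) (ratio-* l m n) ⟨
  ℚ.∣ q ℚ.* r ℚ.- ½ ℚ.* r ∣
    ≡⟨ cong ℚ.∣_∣ (solve 2 (λ q r → q :* r :- con ½ :* r := (q :- con ½) :* r) refl q r) ⟩
  ℚ.∣ (q ℚ.- ½) ℚ.* r ∣
    ≡⟨ ℚ.∣p*q∣≡∣p∣*∣q∣ (q ℚ.- ½) r ⟩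
  ℚ.∣ q ℚ.- ½ ∣ ℚ.* ℚ.∣ r ∣
    ≡⟨ cong (ℚ.∣ q ℚ.- ½ ∣ ℚ.*_) (ℚ.0≤p⇒∣p∣≡p (0≤ratio (suc m) (suc n))) ⟩
  ℚ.∣ q ℚ.- ½ ∣ ℚ.* r
    ≤⟨ ℚ.*-monoˡ-≤-nonNeg ℚ.∣ q ℚ.- ½ ∣ {{ℚ.∣-∣-nonNeg (q ℚ.- ½)}}
         (subst (r ℚ.≤_) (ratio-self n) (ratio-mono-≤ (suc n) m≤n)) ⟩
  ℚ.∣ q ℚ.- ½ ∣ ℚ.* 1ℚ
    ≡⟨ ℚ.*-identityʳ _ ⟩
  ℚ.∣ q ℚ.- ½ ∣ ∎
  where
  open ℚ.≤-Reasoning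
  open +-*-Solver using (solve; _:=_; _:*_; _:-_; con)
  q = ratio l (suc m)
  r = ratio (suc m) (suc n)

bisects⇒halfOn : ∀ {S B} →
  (λ n → ratio (count (S ∩ B) n) (count B n)) ⟶ fromℚ ½ → HalfOn S B
close (half (bisects⇒halfOn {S} {B} h)) ε 0<ε =
  let N , near = close (⟶⇒~ (λ n → ratio (count (S ∩ B) n) (count B n)) (fromℚ ½) h) ε 0<ε
  in N , λ n N≤n → ℚ.≤-<-trans (ratio-halves (count-∩-≤ S B n) (count-≤ B n)) (near n N≤n)

if-same : ∀ b {x : Bool} → (if b then x else x) ≡ x
if-same true  = refl
if-same false = refl

-- Generated fields

adjoin : Family → 𝒫ω → Family
adjoin 𝒜 S = record
  { Mem  = λ A → A ∈ Mem 𝒜 ⊎ S ≗ A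
  ; resp = λ A≗B → Sum.map (resp 𝒜 A≗B) λ S≗A n → trans (S≗A n) (A≗B n)
  }

infix 5 _▹_∣_

_▹_∣_ : 𝒫ω → 𝒫ω → 𝒫ω → 𝒫ω
(S ▹ C ∣ D) n = if S n then C n else D n

-- The form is preserved because complement and intersection act on the two branches separately; S
-- itself has the branches ω and ∅, a member of 𝒜 has both branches equal.
adjoin-decompose : ∀ {𝒜 S B} → B ∈ ⟨ adjoin 𝒜 S ⟩ →
  ∃[ C ] ∃[ D ] C ∈ ⟨ 𝒜 ⟩ × D ∈ ⟨ 𝒜 ⟩ × B ≗ (S ▹ C ∣ D)
adjoin-decompose {S = S} (gen {A} (inj₁ A∈𝒜)) =
  A , A , gen A∈𝒜 , gen A∈𝒜 , λ n → sym (if-same (S n))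
adjoin-decompose {S = S} (gen (inj₂ S≗A)) =
  ω , ∁ ω , whole , compl whole , λ n → trans (sym (S≗A n)) (if-true-false (S n))
  where
  if-true-false : ∀ b → b ≡ (if b then true else false)
  if-true-false true  = refl
  if-true-false false = refl
adjoin-decompose {S = S} whole = ω , ω , whole , whole , λ n → sym (if-same (S n))
adjoin-decompose {S = S} (compl B∈) =
  let C , D , C∈ , D∈ , B≗ = adjoin-decompose B∈
  in ∁ C , ∁ D , compl C∈ , compl D∈ , λ n → trans (cong not (B≗ n)) (if-float not (S n))
adjoin-decompose {S = S} (inter B∈ B′∈) =
  let C , D , C∈ , D∈ , B≗ = adjoin-decompose B∈
      C′ , D′ , C′∈ , D′∈ , B′≗ = adjoin-decompose B′∈
  in C ∩ C′ , D ∩ D′ , inter C∈ C′∈ , inter D∈ D′∈ ,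
     λ n → trans (cong₂ _∧_ (B≗ n) (B′≗ n)) (if-∧ (S n))
  where
  if-∧ : ∀ b {c c′ d d′} → (if b then c else d) ∧ (if b then c′ else d′) ≡
                           (if b then c ∧ c′ else d ∧ d′)
  if-∧ true  = refl
  if-∧ false = refl
adjoin-decompose (ext B≗B′ B∈) =
  let C , D , C∈ , D∈ , B≗ = adjoin-decompose B∈
  in C , D , C∈ , D∈ , λ n → trans (sym (B≗B′ n)) (B≗ n)

⟨⟩-mono : ∀ {𝒜 ℬ} → Mem 𝒜 ⊆ Mem ℬ → ⟨ 𝒜 ⟩ ⊆ ⟨ ℬ ⟩
⟨⟩-mono 𝒜⊆ℬ (gen A∈𝒜)    = gen (𝒜⊆ℬ A∈𝒜)
⟨⟩-mono 𝒜⊆ℬ whole        = whole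
⟨⟩-mono 𝒜⊆ℬ (compl A∈)   = compl (⟨⟩-mono 𝒜⊆ℬ A∈)
⟨⟩-mono 𝒜⊆ℬ (inter A∈ B∈) = inter (⟨⟩-mono 𝒜⊆ℬ A∈) (⟨⟩-mono 𝒜⊆ℬ B∈)
⟨⟩-mono 𝒜⊆ℬ (ext A≗B A∈) = ext A≗B (⟨⟩-mono 𝒜⊆ℬ A∈)

⋂∈⟨⟩ : ∀ {𝒜 F} → All (Mem 𝒜) F → ⋂ F ∈ ⟨ 𝒜 ⟩
⋂∈⟨⟩ []       = whole
⋂∈⟨⟩ (A∈ ∷ F⊆) = inter (gen A∈) (⋂∈⟨⟩ F⊆)

Halves : 𝒫ω → Family → Set
Halves S 𝒜 = ∀ {B} → B ∈ ⟨ 𝒜 ⟩ → HalfOn S B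

-- A finite family is halved by some set

-- Iterated `adjoin`, so that `adjoin-decompose` drives inductions on the list.
fromList : List 𝒫ω → Family
fromList []      = record { Mem = λ _ → ⊥ ; resp = λ _ () }
fromList (A ∷ F) = adjoin (fromList F) A

⟨⟩-trivial : ∀ {B} → B ∈ ⟨ fromList [] ⟩ → ∃[ b ] ∀ n → B n ≡ b
⟨⟩-trivial whole = true , λ _ → refl
⟨⟩-trivial (compl B∈) = let b , B≗ = ⟨⟩-trivial B∈ in not b , cong not ∘ B≗
⟨⟩-trivial (inter B∈ C∈) =
  let b , B≗ = ⟨⟩-trivial B∈
      c , C≗ = ⟨⟩-trivial C∈
  in b ∧ c , λ n → cong₂ _∧_ (B≗ n) (C≗ n)
⟨⟩-trivial (ext B≗C B∈) = let b , B≗ = ⟨⟩-trivial B∈ in b , λ n → trans (sym (B≗C n)) (B≗ n)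

even : ℕ → Bool
even zero    = true
even (suc n) = not (even n)

-- Meets E in its first, third, fifth, ... element.
alternate : 𝒫ω → 𝒫ω
alternate E n = even (count E n)

-- The correction is 1 when an odd number of elements of E has passed, one more of them chosen than
-- skipped.
count-alternate : ∀ E n → let c = count (alternate E ∩ E) n in
  c ℕ.+ c ≡ (if even (count E n) then 0 else 1) ℕ.+ count E n
count-alternate E zero = refl
count-alternate E (suc n) with E n | even (count E n) in eq | count-alternate E n
... | true  | true  | ih rewrite eq = cong suc (trans (ℕ.+-suc _ _) (cong suc ih))
... | true  | false | ih rewrite eq = ih
... | false | true  | ih rewrite eq = ih
... | false | false | ih rewrite eq = ih

alternate-halves : ∀ E → HalfOn (alternate E) E
alternate-halves E = halfOn-balanced 1
  (λ n → subst (ℕ._≤ 1 ℕ.+ count E n) (sym (count-alternate E n))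
    (ℕ.+-monoˡ-≤ (count E n) (bit≤1 (even (count E n)))))
  (λ n → subst (λ k → count E n ℕ.≤ 1 ℕ.+ k) (sym (count-alternate E n))
    (ℕ.m≤n⇒m≤1+n (ℕ.m≤n+m (count E n) (if even (count E n) then 0 else 1))))
  where
  bit≤1 : ∀ b → (if b then 0 else 1) ℕ.≤ 1
  bit≤1 true  = z≤n
  bit≤1 false = s≤s z≤n

-- The relativisation to E makes the induction go through: the two parts into which the head A
-- cuts E are halved independently.
finite-halved : ∀ F E → ∃[ S ] ∀ {B} → B ∈ ⟨ fromList F ⟩ → HalfOn S (B ∩ E)
finite-halved [] E = alternate E , λ B∈ → trivial (⟨⟩-trivial B∈)
  where
  trivial : ∀ {B} → (∃[ b ] ∀ n → B n ≡ b) → HalfOn (alternate E) (B ∩ E)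
  trivial (true  , B≗) = halfOn-resp (λ n → cong (_∧ E n) (sym (B≗ n))) (alternate-halves E)
  trivial (false , B≗) = halfOn-finite {m = 0} λ n _ → cong (_∧ E n) (B≗ n)
finite-halved (A ∷ F) E =
  let S , S-halves = finite-halved F (A ∩ E)
      T , T-halves = finite-halved F (∁ A ∩ E)
  in (A ▹ S ∣ T) , λ {B} B∈ →
    let C , D , C∈ , D∈ , B≗ = adjoin-decompose B∈
    -- Inside A the new set agrees with S and B with C; outside A they agree with T and D.
    in halfOn-split A
      (halfOn-cong
        (λ n → trans (cong (λ b → (if A n then S n else T n) ∧ A n ∧ b ∧ E n) (B≗ n))
                 (inside (A n) (S n) (T n) (C n) (D n) (E n)))
        (λ n → trans (cong (λ b → A n ∧ b ∧ E n) (B≗ n)) (inside′ (A n) (C n) (D n) (E n)))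
        (S-halves C∈))
      (halfOn-cong
        (λ n → trans (cong (λ b → (if A n then S n else T n) ∧ not (A n) ∧ b ∧ E n) (B≗ n))
                 (outside (A n) (S n) (T n) (C n) (D n) (E n)))
        (λ n → trans (cong (λ b → not (A n) ∧ b ∧ E n) (B≗ n)) (outside′ (A n) (C n) (D n) (E n)))
        (T-halves D∈))
  where
  inside′ : ∀ a c d e → a ∧ (if a then c else d) ∧ e ≡ c ∧ a ∧ e
  inside′ true  c d e = refl
  inside′ false c d e = sym (∧-zeroʳ c)
  outside′ : ∀ a c d e → not a ∧ (if a then c else d) ∧ e ≡ d ∧ not a ∧ e
  outside′ true  c d e = sym (∧-zeroʳ d)
  outside′ false c d e = refl
  inside : ∀ a s t c d e →
    (if a then s else t) ∧ a ∧ (if a then c else d) ∧ e ≡ s ∧ c ∧ a ∧ e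
  inside true  s t c d e = refl
  inside false s t c d e = trans (∧-zeroʳ t) (sym (trans (cong (s ∧_) (∧-zeroʳ c)) (∧-zeroʳ s)))
  outside : ∀ a s t c d e →
    (if a then s else t) ∧ not a ∧ (if a then c else d) ∧ e ≡ t ∧ d ∧ not a ∧ e
  outside true  s t c d e = trans (∧-zeroʳ s) (sym (trans (cong (t ∧_) (∧-zeroʳ d)) (∧-zeroʳ t)))
  outside false s t c d e = refl

-- A set that halves the field of a d-independent family can be adjoined to the family

module _ {𝒜 : Family} (indep : IsDIndependent 𝒜) {S : 𝒫ω} (halves : Halves S 𝒜) where
  open IsDIndependent indep

  private
    ℬ : Family
    ℬ = adjoin 𝒜 S

  dens-halving : dens S ~ λ _ → ½
  dens-halving = ~-trans (≗⇒~ λ n → sym (dens-cong (∩-ω S) n)) (~-trans (half (halves whole)) (~-½ dens-ω))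

  -- A member S of 𝒜 would halve itself and so have density ¼ besides ½; the tolerance ¼ equals the
  -- gap between them, so strict closeness fails.
  halving-fresh : S ∉ Mem 𝒜
  halving-fresh S∈𝒜 =
    let N , near = close (~-trans (~-sym dens-halving) dens-S~¼) ¼ (ℚ.positive⁻¹ ¼)
    in ℚ.<-irrefl refl (near N ℕ.≤-refl)
    where
    ¼ = ½ ℚ.* ½
    dens-S~¼ : dens S ~ λ _ → ¼
    dens-S~¼ = ~-trans (≗⇒~ (dens-cong λ n → sym (∧-idem (S n))))
      (~-trans (half (halves (gen S∈𝒜))) (~-½ dens-halving))

  adjoin-density-in-0-1 : ∀ {A x} → A ∈ Mem ℬ → HasDensity A x →
                          fromℚ 0ℚ <ᵣ x × x <ᵣ fromℚ 1ℚ
  adjoin-density-in-0-1 {A} {x} (inj₁ A∈𝒜) A-dens = density-in-0-1 {A} {x} A∈𝒜 A-dens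
  adjoin-density-in-0-1 {A} {x} (inj₂ S≗A) A-dens = ~½⇒in-0-1 x
    (~-trans (~-sym (⟶⇒~ (dens A) x A-dens)) (~-trans (≗⇒~ λ n → sym (dens-cong S≗A n)) dens-halving))

  -- B meets S in half of C and the complement of S in half of D, so its density is (x + y) / 2.
  adjoin-field⊆𝒟 : ⟨ ℬ ⟩ ⊆ 𝒟
  adjoin-field⊆𝒟 {B} B∈ =
    let C , D , C∈ , D∈ , B≗ = adjoin-decompose B∈
        x , C-dens = field⊆𝒟 C∈
        y , D-dens = field⊆𝒟 D∈
        -- There is no addition on ℝ.
        z = fromℚ ½ *ᵣ x -ᵣ fromℚ (ℚ.- ½) *ᵣ y
        S∩B~ = ~-trans (≗⇒~ (dens-cong λ n → trans (cong (S n ∧_) (B≗ n)) (inside (S n))))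
                 (~-trans (half (halves C∈)) (~-½ (⟶⇒~ (dens C) x C-dens)))
        ∁S∩B~ = ~-trans (≗⇒~ (dens-cong λ n → trans (cong (not (S n) ∧_) (B≗ n)) (outside (S n))))
                 (~-trans (half (halfOn-∁ (halves D∈))) (~-½ (⟶⇒~ (dens D) y D-dens)))
    in z , ~⇒⟶ z (~-trans (≗⇒~ (dens-split S B)) (~-trans (~-+ S∩B~ ∁S∩B~)
         (≗⇒~ λ n → solve 2 (λ x y → con ½ :* x :+ con ½ :* y := con ½ :* x :- con (ℚ.- ½) :* y) refl
           (seq x n) (seq y n))))
    where
    open +-*-Solver
    inside : ∀ s {c d} → s ∧ (if s then c else d) ≡ s ∧ c
    inside true  = refl
    inside false = refl
    outside : ∀ s {c d} → not s ∧ (if s then c else d) ≡ not s ∧ d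
    outside true  = refl
    outside false = refl

  -- Includes the empty list, with intersection ω and product 1, which is what remains when F
  -- consists of S alone.
  ⋂-density : ∀ {G ys} → All (Mem 𝒜) G → Unique 𝒫ω-setoid G → Pointwise HasDensity G ys →
              dens (⋂ G) ~ seq (productᵣ ys)
  ⋂-density []         []         []         = dens-ω
  ⋂-density {G} {ys} (A∈ ∷ G⊆) (A∉ ∷ G-uniq) (d ∷ ds) = ⟶⇒~ (dens (⋂ G)) (productᵣ ys)
    (independent G ys (λ ()) (A∈ ∷ G⊆) (A∉ ∷ G-uniq) (d ∷ ds))

  -- F with its one occurrence of S removed. `≉-rest` lets uniqueness of the rest be rebuilt along
  -- the recursion, and `occurs` excludes a second occurrence of S.
  record SplitOff (F : List 𝒫ω) (xs : List ℝ) : Set where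
    field
      rest      : List 𝒫ω
      densities : List ℝ
      rest⊆     : All (Mem 𝒜) rest
      unique    : Unique 𝒫ω-setoid rest
      pointwise : Pointwise HasDensity rest densities
      ⋂-split   : ⋂ F ≗ S ∩ ⋂ rest
      ∏-split   : seq (productᵣ xs) ~ λ n → ½ ℚ.* seq (productᵣ densities) n
      ≉-rest    : ∀ {A} → All (λ B → ¬ A ≗ B) F → All (λ B → ¬ A ≗ B) rest
      occurs    : ¬ All (λ B → ¬ S ≗ B) F

  splitOff : ∀ {F xs} → All (Mem ℬ) F → Unique 𝒫ω-setoid F → Pointwise HasDensity F xs →
             All (Mem 𝒜) F ⊎ SplitOff F xs
  splitOff [] [] [] = inj₁ []
  splitOff {A ∷ F} {x ∷ xs} (A∈ ∷ F⊆) (A∉ ∷ F-uniq) (d ∷ ds) with A∈ | splitOff F⊆ F-uniq ds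
  ... | inj₁ A∈𝒜 | inj₁ F⊆𝒜 = inj₁ (A∈𝒜 ∷ F⊆𝒜)
  ... | inj₁ A∈𝒜 | inj₂ o = inj₂ record
    { rest      = A ∷ rest
    ; densities = x ∷ densities
    ; rest⊆     = A∈𝒜 ∷ rest⊆
    ; unique    = ≉-rest A∉ ∷ unique
    ; pointwise = d ∷ pointwise
    ; ⋂-split   = λ n → trans (cong (A n ∧_) (⋂-split n)) (∧-swap (A n) (S n) (⋂ rest n))
    ; ∏-split   = ~-trans (~-*ˡ (cauchy⇒bounded x) ∏-split)
        (≗⇒~ λ n → solve 2 (λ x y → x :* (con ½ :* y) := con ½ :* (x :* y)) refl
          (seq x n) (seq (productᵣ densities) n))
    ; ≉-rest    = λ { (A≉ ∷ F≉) → A≉ ∷ ≉-rest F≉ }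
    ; occurs    = occurs ∘ All.tail
    }
    where
    open SplitOff o
    open +-*-Solver
  ... | inj₂ S≗A | inj₁ F⊆𝒜 = inj₂ record
    { rest      = F
    ; densities = xs
    ; rest⊆     = F⊆𝒜
    ; unique    = F-uniq
    ; pointwise = ds
    ; ⋂-split   = λ n → cong (_∧ ⋂ F n) (sym (S≗A n))
    ; ∏-split   = ~-trans (≗⇒~ λ n → ℚ.*-comm (seq x n) (seq (productᵣ xs) n))
        (~-trans (~-*ˡ (cauchy⇒bounded (productᵣ xs)) x~½)
          (≗⇒~ λ n → ℚ.*-comm (seq (productᵣ xs) n) ½))
    ; ≉-rest    = All.tail
    ; occurs    = λ { (S≉A ∷ _) → S≉A S≗A }
    }
    where
    x~½ : seq x ~ λ _ → ½
    x~½ = ~-trans (~-sym (⟶⇒~ (dens A) x d))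
      (~-trans (≗⇒~ λ n → sym (dens-cong S≗A n)) dens-halving)
  -- S would occur twice in F, against uniqueness.
  ... | inj₂ S≗A | inj₂ o =
    contradiction (All.map (λ A≉B S≗B → A≉B λ n → trans (sym (S≗A n)) (S≗B n)) A∉)
      (SplitOff.occurs o)

  adjoin-independent : ∀ F xs → F ≢ [] → All (Mem ℬ) F → Unique 𝒫ω-setoid F →
                       Pointwise HasDensity F xs → HasDensity (⋂ F) (productᵣ xs)
  adjoin-independent F xs F≢[] F⊆ F-uniq F-dens with splitOff F⊆ F-uniq F-dens
  ... | inj₁ F⊆𝒜 = independent F xs F≢[] F⊆𝒜 F-uniq F-dens
  ... | inj₂ o = ~⇒⟶ (productᵣ xs)
    -- S halves the intersection of the rest, and ½ is the factor that S contributes to the product.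
    (~-trans (≗⇒~ (dens-cong ⋂-split)) (~-trans (half (halves (⋂∈⟨⟩ rest⊆)))
      (~-trans (~-½ (⋂-density rest⊆ unique pointwise)) (~-sym ∏-split))))
    where open SplitOff o

  adjoin-isDIndependent : IsDIndependent ℬ
  adjoin-isDIndependent = record
    { nonempty       = S , inj₂ λ _ → refl
    ; ⊆𝒟             = adjoin-field⊆𝒟 ∘ gen
    ; density-in-0-1 = λ {A} {x} → adjoin-density-in-0-1 {A} {x}
    ; field⊆𝒟        = adjoin-field⊆𝒟
    ; independent    = adjoin-independent
    }

  halved⇒¬maximal : ¬ IsMaximalDIndependent 𝒜
  halved⇒¬maximal (_ , maximal) = maximal
    (ℬ , adjoin-isDIndependent , inj₁ , λ ℬ⊆𝒜 → halving-fresh (ℬ⊆𝒜 (inj₂ λ _ → refl)))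

maximal⇒¬finite : ∀ {𝒜} → IsMaximalDIndependent 𝒜 → ∀ F → ¬ (Mem 𝒜 ⊆ Mem (fromList F))
maximal⇒¬finite 𝒜-max F 𝒜⊆F =
  let S , S-halves = finite-halved F ω
  in halved⇒¬maximal (proj₁ 𝒜-max)
       (λ {B} B∈ → halfOn-resp (∩-ω B) (S-halves (⟨⟩-mono 𝒜⊆F B∈))) 𝒜-max

-- Binary trees and their coding by natural numbers

data Tree (A : Set) : Set where
  leaf : A → Tree A
  node : Tree A → Tree A → Tree A

map : {A B : Set} → (A → B) → Tree A → Tree B
map f (leaf x)   = leaf (f x)
map f (node s t) = node (map f s) (map f t)

leaf-injective : {A : Set} {x y : A} → leaf x ≡ leaf y → x ≡ y
leaf-injective refl = refl

node-injective : {A : Set} {s s′ t t′ : Tree A} → node s t ≡ node s′ t′ → s ≡ s′ × t ≡ t′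
node-injective refl = refl , refl

map-injective : {A B : Set} {f : A → B} → Injective _≡_ _≡_ f → Injective _≡_ _≡_ (map f)
map-injective f-inj {leaf _} {leaf _} eq = cong leaf (f-inj (leaf-injective eq))
map-injective f-inj {node _ _} {node _ _} eq =
  let p , q = node-injective eq in cong₂ node (map-injective f-inj p) (map-injective f-inj q)

-- The number 2^m (2n + 1); parity recovers m, then n.
pair : ℕ → ℕ → ℕ
pair zero    n = suc (2 ℕ.* n)
pair (suc m) n = 2 ℕ.* pair m n

pair-injective : ∀ m m′ {n n′} → pair m n ≡ pair m′ n′ → m ≡ m′ × n ≡ n′
pair-injective zero zero eq = refl , ℕ.*-cancelˡ-≡ _ _ 2 (ℕ.suc-injective eq)
pair-injective zero (suc m′) {n} {n′} eq = contradiction (sym eq) (ℕ.even≢odd (pair m′ n′) n)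
pair-injective (suc m) zero {n} {n′} eq = contradiction eq (ℕ.even≢odd (pair m n) n′)
pair-injective (suc m) (suc m′) eq =
  let p , q = pair-injective m m′ (ℕ.*-cancelˡ-≡ _ _ 2 eq) in cong suc p , q

-- First component 0 marks a leaf, a positive one a node. This coding starts the construction over
-- an arbitrary infinite set.
encode : Tree ℕ → ℕ
encode (leaf n)   = pair 0 n
encode (node s t) = pair (suc (encode s)) (encode t)

encode-injective : Injective _≡_ _≡_ encode
encode-injective {leaf m} {leaf n} eq = cong leaf (proj₂ (pair-injective 0 0 {m} {n} eq))
encode-injective {leaf n} {node s t} eq with () ← proj₁ (pair-injective 0 (suc (encode s)) {n} {encode t} eq)
encode-injective {node s t} {leaf n} eq with () ← proj₁ (pair-injective (suc (encode s)) 0 {encode t} {n} eq)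
encode-injective {node s t} {node s′ t′} eq =
  let p , q = pair-injective (suc (encode s)) (suc (encode s′)) eq
  in cong₂ node (encode-injective (ℕ.suc-injective p)) (encode-injective q)

-- Choice from S into its carrier under `_≡_`: congruence of the choice function says that
-- equivalent elements have identical representatives.
canonical : AxiomOfChoice 0ℓ 0ℓ 0ℓ 0ℓ 0ℓ → (S : Setoid 0ℓ 0ℓ) → let open Setoid S in
  Σ (Carrier → Carrier) λ rep → (∀ x → x ≈ rep x) × (∀ {x y} → x ≈ y → rep x ≡ rep y)
canonical ac S =
  let f , x≈fx = ac S (setoid Carrier) _≈_ (λ { p refl q → S.trans (S.sym p) q }) (λ x → x , S.refl)
  in Func.to f , x≈fx , Func.cong f
  where
  module S = Setoid S
  open Setoid S using (Carrier; _≈_)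

-- Subsets under excluded middle

module Classical (em : ∀ {ℓ} → ExcludedMiddle ℓ) where

  private variable
    a : Level
    A B U : Set

  χ : (U → Set a) → U → Bool
  χ P u = does (em {P = P u})

  χ-intro : (P : U → Set a) → ∀ {u} → P u → χ P u ≡ true
  χ-intro P {u} p = dec-true (em {P = P u}) p

  χ-elim : (P : U → Set a) → ∀ {u} → χ P u ≡ true → P u
  χ-elim P {u} eq with em {P = P u}
  ... | yes p = p
  χ-elim P {u} () | no _

  excludedMiddle : (P : Set a) → P ⊎ ¬ P
  excludedMiddle P = toSum em

  all-or-counterexample : {P Q : U → Set a} → (∀ u → P u ⊎ Q u) → (∀ u → P u) ⊎ ∃ Q
  all-or-counterexample {Q = Q} h with em {P = ∃ Q}
  ... | yes q = inj₂ q
  ... | no ¬q = inj₁ λ u → [ id , (λ q → contradiction (u , q) ¬q) ]′ (h u)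

  -- Zorn's lemma, following Bourbaki and Witt: the tower generated by an inflationary operation
  -- and unions is a chain, so its union is a fixed point.

  infix 4 _⊑_

  _⊑_ : (S T : U → Bool) → Set
  S ⊑ T = ∀ u → S u ≡ true → T u ≡ true

  ⊑-trans : {S T V : U → Bool} → S ⊑ T → T ⊑ V → S ⊑ V
  ⊑-trans p q u = q u ∘ p u

  ⊑-antisym : {S T : U → Bool} → S ⊑ T → T ⊑ S → S ≗ T
  ⊑-antisym {S = S} {T} p q u with S u in eq | T u in eq′
  ... | true  | true  = refl
  ... | false | false = refl
  ... | true  | false = trans (sym (p u eq)) eq′
  ... | false | true  = trans (sym eq) (q u eq′)

  Covered : ((U → Bool) → Set) → U → Set
  Covered 𝒞 u = ∃[ S ] 𝒞 S × S u ≡ true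

  -- A relation, so that every extensional copy of a union qualifies; hence closure under unions
  -- entails invariance under `_≗_` in `chainClosed⇒resp`.
  record IsUnion (𝒞 : (U → Bool) → Set) (T : U → Bool) : Set where
    field
      covers : ∀ {u} → T u ≡ true → Covered 𝒞 u
      upper  : ∀ S → 𝒞 S → S ⊑ T

    least : ∀ {V} → (∀ S → 𝒞 S → S ⊑ V) → T ⊑ V
    least h u Tu = let S , S∈𝒞 , Su = covers Tu in h S S∈𝒞 u Su

  open IsUnion

  ⋃ : ((U → Bool) → Set) → U → Bool
  ⋃ 𝒞 = χ (Covered 𝒞)

  ⋃-isUnion : (𝒞 : (U → Bool) → Set) → IsUnion 𝒞 (⋃ 𝒞)
  ⋃-isUnion 𝒞 = record
    { covers = χ-elim (Covered 𝒞)
    ; upper  = λ S S∈𝒞 u Su → χ-intro (Covered 𝒞) (S , S∈𝒞 , Su)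
    }

  IsChain : ((U → Bool) → Set) → Set
  IsChain 𝒞 = ∀ S T → 𝒞 S → 𝒞 T → S ⊑ T ⊎ T ⊑ S

  -- The chain may be empty: Φ then holds of the empty set, from which the tower starts.
  ChainClosed : ((U → Bool) → Set) → Set₁
  ChainClosed Φ = ∀ 𝒞 T → IsChain 𝒞 → (∀ S → 𝒞 S → Φ S) → IsUnion 𝒞 T → Φ T

  data Tower (f : (U → Bool) → U → Bool) : (U → Bool) → Set₁ where
    next : ∀ {S} → Tower f S → Tower f (f S)
    sup  : ∀ {𝒞 T} → IsUnion 𝒞 T → (∀ S → 𝒞 S → Tower f S) → Tower f T

  module _ {f : (U → Bool) → U → Bool} (inflationary : ∀ S → S ⊑ f S)
           (respects : ∀ {S T} → S ≗ T → f S ⊑ f T) where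

    squeeze : ∀ {S T} → S ⊑ T → T ⊑ S → f S ⊑ f T
    squeeze p q = respects (⊑-antisym p q)

    -- Double induction. Having f T ⊑ S instead of T ⊑ S in the second alternative says that nothing
    -- lies strictly between T and f T, which the successor cases use. Where two sets include each
    -- other, `squeeze` passes to their images.
    comparable : ∀ {S T} → Tower f S → Tower f T → S ⊑ T ⊎ f T ⊑ S
    comparable {T = T} (sup ∪ h) y
      with all-or-counterexample (λ ((S , S∈𝒞) : ∃ _) → comparable (h S S∈𝒞) y)
    ... | inj₁ all = inj₁ (least ∪ λ S S∈𝒞 → all (S , S∈𝒞))
    ... | inj₂ ((S , S∈𝒞) , fT⊑S) = inj₂ (⊑-trans fT⊑S (upper ∪ S S∈𝒞))
    comparable (next {S} x) (sup ∪ h)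
      with comparable x (sup ∪ h)
         | all-or-counterexample (λ ((D , D∈𝒟) : ∃ _) → comparable (h D D∈𝒟) x)
    ... | inj₂ q | _ = inj₂ (⊑-trans q (inflationary S))
    ... | inj₁ p | inj₁ all = inj₂ (squeeze (least ∪ λ D D∈𝒟 → all (D , D∈𝒟)) p)
    ... | inj₁ p | inj₂ ((D , D∈𝒟) , q) = inj₁ (⊑-trans q (upper ∪ D D∈𝒟))
    comparable (next {S} x) (next {T} y)
      with comparable x (next y) | comparable y x | comparable x y
    ... | inj₂ q | _ | _ = inj₂ (⊑-trans q (inflationary S))
    ... | inj₁ _ | inj₂ q | _ = inj₁ (⊑-trans q (inflationary T))
    ... | inj₁ _ | inj₁ q | inj₁ p = inj₁ (squeeze p q)
    ... | inj₁ p | inj₁ _ | inj₂ q = inj₂ (squeeze q p)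

    tower-chain : ∀ {S T} → Tower f S → Tower f T → S ⊑ T ⊎ T ⊑ S
    tower-chain {T = T} x y with comparable x y
    ... | inj₁ p = inj₁ p
    ... | inj₂ q = inj₂ (⊑-trans (inflationary T) q)

    tower-invariant : (Φ : (U → Bool) → Set) → ChainClosed Φ → (∀ {S} → Φ S → Φ (f S)) →
                      ∀ {S} → Tower f S → Φ S
    tower-invariant Φ closed step (next x) = step (tower-invariant Φ closed step x)
    tower-invariant Φ closed step (sup {𝒞} {T} ∪ h) =
      closed 𝒞 T (λ S V p q → tower-chain (h S p) (h V q))
        (λ S S∈𝒞 → tower-invariant Φ closed step (h S S∈𝒞)) ∪

    -- The union of the whole tower belongs to the tower, hence so does its image under f, which the
    -- union therefore contains.
    tower-fixpoint : ∃[ M ] Tower f M × f M ⊑ M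
    tower-fixpoint = M , M∈Tower , upper M-union (f M) (χ-intro (Tower f) (next M∈Tower))
      where
      -- `Tower f` lives one universe too high for `sup`; deciding it by `χ` lowers it.
      𝒞 : (U → Bool) → Set
      𝒞 S = χ (Tower f) S ≡ true
      M : U → Bool
      M = ⋃ 𝒞
      M-union : IsUnion 𝒞 M
      M-union = ⋃-isUnion 𝒞
      M∈Tower : Tower f M
      M∈Tower = sup M-union λ S → χ-elim (Tower f)

  IsMaximal : ((U → Bool) → Set) → (U → Bool) → Set
  IsMaximal Φ M = Φ M × (∀ T → Φ T → M ⊑ T → T ⊑ M)

  -- S alone forms a chain, and T is a union of it.
  chainClosed⇒resp : {Φ : (U → Bool) → Set} → ChainClosed Φ → ∀ {S T} → S ≗ T → Φ S → Φ T
  chainClosed⇒resp closed {S} {T} S≗T ΦS = closed (_≡ S) T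
    (λ { _ _ refl refl → inj₁ λ _ → id })
    (λ { _ refl → ΦS })
    record
      { covers = λ Tu → S , refl , trans (S≗T _) Tu
      ; upper  = λ { _ refl u Su → trans (sym (S≗T u)) Su }
      }

  module WithChoice (ac : AxiomOfChoice 0ℓ 0ℓ 0ℓ 0ℓ 0ℓ) where

    -- The operation f enlarges a set properly within Φ if it can, so a fixed point is maximal. It
    -- acts on `rep S`, which makes it respect `_≗_`.
    zorn : (Φ : (U → Bool) → Set) → ChainClosed Φ → ∃ (IsMaximal Φ)
    zorn {U = U} Φ closed =
      let M , M∈Tower , fM⊑M = tower-fixpoint inflationary respects
          ΦM = tower-invariant inflationary respects Φ closed Φ-f M∈Tower
      in M , ΦM , λ T ΦT M⊑T →
           ⊑-trans (maximal (rep M) (resp′ (≗rep M) ΦM) (⊑-trans (fM⊑M) (⊑rep M)) T ΦT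
             (⊑-trans (rep⊑ M) M⊑T)) (rep⊑ M)
      where
      resp′ : ∀ {S T} → S ≗ T → Φ S → Φ T
      resp′ = chainClosed⇒resp closed

      Proper : (U → Bool) → (U → Bool) → Set
      Proper S T = Φ T × S ⊑ T × ¬ (T ⊑ S)

      enlarge : (S : U → Bool) → Dec (∃ (Proper S)) → U → Bool
      enlarge S (yes (T , _)) = T
      enlarge S (no _)        = S

      reps = canonical ac (U →-setoid Bool)
      rep = proj₁ reps
      ≗rep = proj₁ (proj₂ reps)

      ⊑rep : ∀ S → S ⊑ rep S
      ⊑rep S u = trans (sym (≗rep S u))

      rep⊑ : ∀ S → rep S ⊑ S
      rep⊑ S u = trans (≗rep S u)

      f : (U → Bool) → U → Bool
      f S = enlarge (rep S) em

      inflationary : ∀ S → S ⊑ f S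
      inflationary S with em {P = ∃ (Proper (rep S))}
      ... | yes (_ , _ , p , _) = ⊑-trans (⊑rep S) p
      ... | no _                = ⊑rep S

      respects : ∀ {S T} → S ≗ T → f S ⊑ f T
      respects S≗T u = subst (λ V → enlarge V em u ≡ true) (proj₂ (proj₂ reps) S≗T)

      Φ-f : ∀ {S} → Φ S → Φ (f S)
      Φ-f {S} ΦS with em {P = ∃ (Proper (rep S))}
      ... | yes (_ , ΦT , _) = ΦT
      ... | no _             = resp′ (≗rep S) ΦS

      maximal : ∀ S → Φ S → enlarge S em ⊑ S → ∀ T → Φ T → S ⊑ T → T ⊑ S
      maximal S ΦS fS⊑S T ΦT S⊑T with em {P = ∃ (Proper S)}
      ... | yes (_ , _ , _ , ¬V⊑S) = contradiction fS⊑S ¬V⊑S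
      ... | no ¬proper with em {P = T ⊑ S}
      ...   | yes T⊑S = T⊑S
      ...   | no ¬T⊑S = contradiction (T , ΦT , S⊑T , ¬T⊑S) ¬proper

    -- Injections and the comparability of cardinals

    infix 0 _↪_

    _↪_ : Set → Set → Set
    A ↪ B = Σ (A → B) (Injective _≡_ _≡_)

    ↪-trans : A ↪ B → B ↪ U → A ↪ U
    ↪-trans (f , f-inj) (g , g-inj) = g ∘ f , f-inj ∘ g-inj

    fresh⇒ℕ↪ : (∀ (xs : List A) → ∃[ x ] ¬ Any (x ≡_) xs) → ℕ ↪ A
    fresh⇒ℕ↪ {A} fresh = term , injective
      where
      prefix : ℕ → List A
      prefix zero    = []
      prefix (suc n) = proj₁ (fresh (prefix n)) ∷ prefix n
      term : ℕ → A
      term n = proj₁ (fresh (prefix n))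
      earlier : ∀ {m n} → m ℕ.<′ n → Any (term m ≡_) (prefix n)
      earlier (ℕ.<′-base)     = here refl
      earlier (ℕ.<′-step m<n) = there (earlier m<n)
      distinct : ∀ {m n} → m ℕ.< n → term m ≢ term n
      distinct {m} {n} m<n eq = proj₂ (fresh (prefix n))
        (subst (λ x → Any (x ≡_) (prefix n)) eq (earlier (ℕ.<⇒<′ m<n)))
      injective : Injective _≡_ _≡_ term
      injective {m} {n} eq with ℕ.<-cmp m n
      ... | tri< m<n _ _ = contradiction eq (distinct m<n)
      ... | tri≈ _ m≡n _ = m≡n
      ... | tri> _ _ n<m = contradiction (sym eq) (distinct n<m)

    chain-both : {𝒞 : (U → Bool) → Set} → IsChain 𝒞 → ∀ {u v} → Covered 𝒞 u → Covered 𝒞 v →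
                 ∃[ S ] 𝒞 S × S u ≡ true × S v ≡ true
    chain-both chain {u} {v} (S , S∈𝒞 , Su) (T , T∈𝒞 , Tv) with chain S T S∈𝒞 T∈𝒞
    ... | inj₁ S⊑T = T , T∈𝒞 , S⊑T u Su , Tv
    ... | inj₂ T⊑S = S , S∈𝒞 , Su , T⊑S v Tv

    record PartialInjection (G : A × B → Bool) : Set where
      field
        functional : ∀ {a b b′} → G (a , b) ≡ true → G (a , b′) ≡ true → b ≡ b′
        injective  : ∀ {a a′ b} → G (a , b) ≡ true → G (a′ , b) ≡ true → a ≡ a′

    -- Each condition involves two pairs, and two pairs covered by a chain lie in one of its
    -- members.
    partialInjection-chainClosed : ChainClosed (PartialInjection {A} {B})
    partialInjection-chainClosed 𝒞 T chain 𝒞⊆ ∪ = record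
      { functional = λ p q →
          let S , S∈𝒞 , Sp , Sq = chain-both chain (covers ∪ p) (covers ∪ q)
          in PartialInjection.functional (𝒞⊆ S S∈𝒞) Sp Sq
      ; injective = λ p q →
          let S , S∈𝒞 , Sp , Sq = chain-both chain (covers ∪ p) (covers ∪ q)
          in PartialInjection.injective (𝒞⊆ S S∈𝒞) Sp Sq
      }

    -- A maximal partial injection exhausts A or B, since otherwise a pair of missed points could be
    -- added.
    ↪-total : (A B : Set) → (A ↪ B) ⊎ (B ↪ A)
    ↪-total A B with zorn (PartialInjection {A} {B}) partialInjection-chainClosed
    ... | M , M-pinj , M-max
      with em {P = ∀ a → ∃[ b ] M (a , b) ≡ true} | em {P = ∀ b → ∃[ a ] M (a , b) ≡ true}
    ... | yes total | _ = inj₁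
          ( proj₁ ∘ total
          , λ {x} {y} eq → injective (proj₂ (total x))
              (subst (λ b → M (y , b) ≡ true) (sym eq) (proj₂ (total y))))
      where open PartialInjection M-pinj
    ... | no _ | yes total = inj₂
          ( proj₁ ∘ total
          , λ {x} {y} eq → functional (proj₂ (total x))
              (subst (λ a → M (a , y) ≡ true) (sym eq) (proj₂ (total y))))
      where open PartialInjection M-pinj
    ... | no ¬left | no ¬right
      with all-or-counterexample (λ a → excludedMiddle (∃[ b ] M (a , b) ≡ true))
         | all-or-counterexample (λ b → excludedMiddle (∃[ a ] M (a , b) ≡ true))
    ... | inj₁ total | _ = contradiction total ¬left
    ... | inj₂ _ | inj₁ total = contradiction total ¬right
    ... | inj₂ (a₀ , a₀∉) | inj₂ (b₀ , b₀∉) =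
      contradiction (b₀ , M-max (χ M⁺) M⁺-pinj (λ p Mp → χ-intro M⁺ (inj₁ Mp)) (a₀ , b₀)
                            (χ-intro M⁺ (inj₂ refl))) a₀∉
      where
      open PartialInjection M-pinj
      M⁺ : A × B → Set
      M⁺ p = M p ≡ true ⊎ p ≡ (a₀ , b₀)
      M⁺-pinj : PartialInjection (χ M⁺)
      M⁺-pinj = record
        { functional = λ p q → fun (χ-elim M⁺ p) (χ-elim M⁺ q)
        ; injective  = λ p q → inj (χ-elim M⁺ p) (χ-elim M⁺ q)
        }
        where
        fun : ∀ {a b b′} → M⁺ (a , b) → M⁺ (a , b′) → b ≡ b′
        fun (inj₁ p) (inj₁ q) = functional p q
        fun (inj₁ p) (inj₂ refl) = contradiction (_ , p) a₀∉
        fun (inj₂ refl) (inj₁ q) = contradiction (_ , q) a₀∉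
        fun (inj₂ refl) (inj₂ refl) = refl
        inj : ∀ {a a′ b} → M⁺ (a , b) → M⁺ (a′ , b) → a ≡ a′
        inj (inj₁ p) (inj₁ q) = injective p q
        inj (inj₁ p) (inj₂ refl) = contradiction (_ , p) b₀∉
        inj (inj₂ refl) (inj₁ q) = contradiction (_ , q) b₀∉
        inj (inj₂ refl) (inj₂ refl) = refl

    -- An infinite set has as many elements as binary trees over it

    module _ {K : Set} where

      Dom : (Tree K × K → Bool) → Tree K → Set
      Dom G t = ∃[ y ] G (t , y) ≡ true

      -- The graphs of injections Tree X → X with X ⊆ K.
      record TreeInjection (G : Tree K × K → Bool) : Set where
        field
          partialInjection : PartialInjection G
          range   : ∀ {t y} → G (t , y) ≡ true → Dom G (leaf y)
          node⁺   : ∀ {s t} → Dom G s → Dom G t → Dom G (node s t)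
          node⁻   : ∀ {s t} → Dom G (node s t) → Dom G s × Dom G t

        open PartialInjection partialInjection public

        -- Membership through `χ` is an equation between Booleans and so has a unique proof;
        -- elements of X are determined by their values in K.
        X : Set
        X = Σ K λ x → χ (Dom G ∘ leaf) x ≡ true

        X-≡ : {x y : X} → proj₁ x ≡ proj₁ y → x ≡ y
        X-≡ {_ , p} {_ , q} refl = cong (_ ,_) (uip p q)

        -- With `dom⁻`, the domain consists of exactly the trees over X.
        dom⁺ : (t : Tree X) → Dom G (map proj₁ t)
        dom⁺ (leaf (_ , x∈X)) = χ-elim (Dom G ∘ leaf) x∈X
        dom⁺ (node s t) = node⁺ (dom⁺ s) (dom⁺ t)

        dom⁻ : ∀ t → Dom G t → ∃[ t′ ] map {A = X} proj₁ t′ ≡ t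
        dom⁻ (leaf x) p = leaf (x , χ-intro (Dom G ∘ leaf) p) , refl
        dom⁻ (node s t) p =
          let s′ , eqs = dom⁻ s (proj₁ (node⁻ p))
              t′ , eqt = dom⁻ t (proj₂ (node⁻ p))
          in node s′ t′ , cong₂ node eqs eqt

        value : ∀ {t} → Dom G t → X
        value (y , Gty) = y , χ-intro (Dom G ∘ leaf) (range Gty)

        value-injective : ∀ {s t} (p : Dom G s) (q : Dom G t) → proj₁ p ≡ proj₁ q → s ≡ t
        value-injective (_ , p) (_ , q) refl = injective p q

        tree↪ : Tree X ↪ X
        tree↪ = (λ t → value (dom⁺ t)) , λ {s} {t} eq →
          map-injective X-≡ (value-injective (dom⁺ s) (dom⁺ t) (cong proj₁ eq))

        sum↪ : X ⊎ X ↪ X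
        sum↪ = ↪-trans (emb , emb-injective) tree↪
          where
          emb : X ⊎ X → Tree X
          emb (inj₁ x) = leaf x
          emb (inj₂ x) = node (leaf x) (leaf x)
          emb-injective : Injective _≡_ _≡_ emb
          emb-injective {inj₁ _} {inj₁ _} refl = refl
          emb-injective {inj₁ _} {inj₂ _} ()
          emb-injective {inj₂ _} {inj₁ _} ()
          emb-injective {inj₂ _} {inj₂ _} refl = refl

      treeInjection-chainClosed : ChainClosed TreeInjection
      treeInjection-chainClosed 𝒞 T chain 𝒞⊆ ∪ = record
        { partialInjection = partialInjection-chainClosed 𝒞 T chain
            (λ S → TreeInjection.partialInjection ∘ 𝒞⊆ S) ∪
        ; range = λ p →
            let S , S∈𝒞 , Sp = covers ∪ p
            in enlarge S∈𝒞 (TreeInjection.range (𝒞⊆ S S∈𝒞) Sp)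
        ; node⁺ = λ (_ , p) (_ , q) →
            let S , S∈𝒞 , Sp , Sq = chain-both chain (covers ∪ p) (covers ∪ q)
            in enlarge S∈𝒞 (TreeInjection.node⁺ (𝒞⊆ S S∈𝒞) (_ , Sp) (_ , Sq))
        ; node⁻ = λ (_ , p) →
            let S , S∈𝒞 , Sp = covers ∪ p
                ds , dt = TreeInjection.node⁻ (𝒞⊆ S S∈𝒞) (_ , Sp)
            in enlarge S∈𝒞 ds , enlarge S∈𝒞 dt
        }
        where
        enlarge : ∀ {S} → 𝒞 S → ∀ {t} → Dom S t → Dom T t
        enlarge S∈𝒞 (y , p) = y , upper ∪ _ S∈𝒞 _ p

      -- Any Y embedded in K with an injection Tree Y → Y yields a tree injection whose X is the
      -- image of Y. The instances are Y = ℕ and, for the extension, X ⊎ X.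
      module Graph {Y : Set} (i↪ : Y ↪ K) (c↪ : Tree Y ↪ Y) where

        private
          i = proj₁ i↪
          i-inj = proj₂ i↪
          c = proj₁ c↪
          c-inj = proj₂ c↪

        Γ : Tree K × K → Set
        Γ (t , y) = ∃[ t′ ] map i t′ ≡ t × i (c t′) ≡ y

        Γ-dom : ∀ t′ → Dom (χ Γ) (map i t′)
        Γ-dom t′ = i (c t′) , χ-intro Γ (t′ , refl , refl)

        Γ-functional : ∀ {t y y′} → Γ (t , y) → Γ (t , y′) → y ≡ y′
        Γ-functional (s , refl , refl) (t , eq , refl) = cong (i ∘ c) (sym (map-injective i-inj eq))

        Γ-injective : ∀ {t t′ y} → Γ (t , y) → Γ (t′ , y) → t ≡ t′
        Γ-injective (s , refl , refl) (t , refl , eq) = cong (map i) (sym (c-inj (i-inj eq)))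

        Γ-range : ∀ {t y} → Γ (t , y) → Dom (χ Γ) (leaf y)
        Γ-range (t , _ , refl) = Γ-dom (leaf (c t))

        Γ-node⁺ : ∀ {s t y z} → Γ (s , y) → Γ (t , z) → Dom (χ Γ) (node s t)
        Γ-node⁺ (s , refl , _) (t , refl , _) = Γ-dom (node s t)

        Γ-node⁻ : ∀ {s t y} → Γ (node s t , y) → Dom (χ Γ) s × Dom (χ Γ) t
        Γ-node⁻ (node s t , refl , _) = Γ-dom s , Γ-dom t

        treeInjection : TreeInjection (χ Γ)
        treeInjection = record
          { partialInjection = record
              { functional = λ p q → Γ-functional (χ-elim Γ p) (χ-elim Γ q)
              ; injective  = λ p q → Γ-injective (χ-elim Γ p) (χ-elim Γ q)
              }
          ; range = Γ-range ∘ χ-elim Γ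
          ; node⁺ = λ (_ , p) (_ , q) → Γ-node⁺ (χ-elim Γ p) (χ-elim Γ q)
          ; node⁻ = λ (_ , p) → Γ-node⁻ (χ-elim Γ p)
          }

      module Extension {M} (M-tree : TreeInjection M) where
        open TreeInjection M-tree

        Complement : Set
        Complement = Σ K λ x → χ (Dom M ∘ leaf) x ≡ false

        Complement-≡ : {x y : Complement} → proj₁ x ≡ proj₁ y → x ≡ y
        Complement-≡ {_ , p} {_ , q} refl = cong (_ ,_) (uip p q)

        splitBy : ∀ x b → χ (Dom M ∘ leaf) x ≡ b → X ⊎ Complement
        splitBy x true  eq = inj₁ (x , eq)
        splitBy x false eq = inj₂ (x , eq)

        split : K → X ⊎ Complement
        split x = splitBy x _ refl

        splitBy-proj₁ : ∀ x b eq → [ proj₁ , proj₁ ]′ (splitBy x b eq) ≡ x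
        splitBy-proj₁ x true  _ = refl
        splitBy-proj₁ x false _ = refl

        -- K embeds in X ⊎ X, hence in X; relabelled along this embedding, trees over K become trees
        -- over X and are coded there.
        tree↪-absorbing : Complement ↪ X → Tree K ↪ K
        tree↪-absorbing (i , i-inj) = ↪-trans (map g , map-injective g-inj)
          (↪-trans tree↪ (proj₁ , X-≡))
          where
          h : X ⊎ Complement → X ⊎ X
          h (inj₁ x) = inj₁ x
          h (inj₂ x) = inj₂ (i x)
          h-inj : ∀ u v → h u ≡ h v → u ≡ v
          h-inj (inj₁ _) (inj₁ _) refl = refl
          h-inj (inj₂ _) (inj₂ _) eq = cong inj₂ (i-inj (inj₂-injective eq))
          h-inj (inj₁ _) (inj₂ _) ()
          h-inj (inj₂ _) (inj₁ _) ()
          g : K → X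
          g = proj₁ sum↪ ∘ h ∘ split
          g-inj : Injective _≡_ _≡_ g
          g-inj {x} {y} eq = trans (sym (splitBy-proj₁ x _ refl))
            (trans (cong [ proj₁ , proj₁ ]′ (h-inj (split x) (split y) (proj₂ sum↪ eq)))
              (splitBy-proj₁ y _ refl))

        module _ (j↪ : X ↪ Complement) where

          private
            j = proj₁ j↪
            j-inj = proj₂ j↪

          disjoint : (x y : X) → proj₁ x ≢ proj₁ (j y)
          disjoint (x , x∈X) y eq with j y
          disjoint (x , x∈X) y refl | _ , x∉X = contradiction (trans (sym x∈X) x∉X) λ ()

          i : X ⊎ X → K
          i (inj₁ x) = proj₁ x
          i (inj₂ x) = proj₁ (j x)

          i-inj : ∀ u v → i u ≡ i v → u ≡ v
          i-inj (inj₁ x) (inj₁ y) eq = cong inj₁ (X-≡ eq)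
          i-inj (inj₁ x) (inj₂ y) eq = contradiction eq (disjoint x y)
          i-inj (inj₂ x) (inj₁ y) eq = contradiction (sym eq) (disjoint y x)
          i-inj (inj₂ x) (inj₂ y) eq = cong inj₂ (j-inj (Complement-≡ eq))

          i↪ : X ⊎ X ↪ K
          i↪ = i , i-inj _ _

          new : Tree (X ⊎ X) → X
          new = proj₁ tree↪ ∘ map (proj₁ sum↪)

          new-injective : Injective _≡_ _≡_ new
          new-injective = map-injective (proj₂ sum↪) ∘ proj₂ tree↪

          -- Old values are kept, new trees get values in the copy j X of X.
          code : ∀ t → Dec (Dom M (map i t)) → X ⊎ X
          code t (yes p) = inj₁ (value p)
          code t (no _)  = inj₂ (new t)

          -- Old and new values lie in different summands, and each kind is injective.
          code-injective : ∀ s t p q → code s p ≡ code t q → s ≡ t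
          code-injective s t (yes p) (yes q) eq =
            map-injective (i-inj _ _) (value-injective p q (cong proj₁ (inj₁-injective eq)))
          code-injective s t (no _) (no _) eq = new-injective (inj₂-injective eq)

          code↪ : Tree (X ⊎ X) ↪ X ⊎ X
          code↪ = (λ t → code t em) , λ {s} {t} → code-injective s t em em

          open Graph i↪ code↪

          code-extends : ∀ t {y} d → M (map i t , y) ≡ true → i (code t d) ≡ y
          code-extends t (yes (_ , q)) Mp = functional q Mp
          code-extends t (no ¬q) Mp = contradiction (_ , Mp) ¬q

          old : (t : Tree X) → map i (map inj₁ t) ≡ map proj₁ t
          old (leaf x)   = refl
          old (node s t) = cong₂ node (old s) (old t)

          M⊑Γ : M ⊑ χ Γ
          M⊑Γ (t , y) Mp =
            let t′ , eq = dom⁻ t (y , Mp)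
                eq′ = trans (old t′) eq
            in χ-intro Γ (map inj₁ t′ , eq′ ,
                 code-extends (map inj₁ t′) em
                   (subst (λ s → M (s , y) ≡ true) (sym eq′) Mp))

          -- The extended graph has the leaf labelled j x in its domain. By maximality M would too,
          -- although j x lies outside X.
          extendable : X → ¬ IsMaximal TreeInjection M
          extendable x (_ , M-max) =
            let y , p = Γ-dom (leaf (inj₂ x))
            in disjoint (proj₁ (j x) , χ-intro (Dom M ∘ leaf) (y , M-max (χ Γ) treeInjection M⊑Γ _ p))
                 x refl

      -- If X were empty, M would be empty and so lie below the tree injection transported from ℕ,
      -- which has leaves in its domain.
      maximal⇒nonempty : ∀ {M} → IsMaximal TreeInjection M → ℕ ↪ K → ∃ (Dom M ∘ leaf)
      maximal⇒nonempty {M} (M-tree , M-max) e with em {P = ∃ (Dom M ∘ leaf)}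
      ... | yes p = p
      ... | no ∄ = y , TreeInjection.range M-tree
                     (M-max (χ Γ) treeInjection (λ _ Mp → contradiction (_ , range Mp) ∄) _ p)
        where
        open TreeInjection M-tree using (range)
        open Graph e (encode , encode-injective)
        y = proj₁ (Γ-dom (leaf 0))
        p = proj₂ (Γ-dom (leaf 0))

      infinite⇒tree↪ : ℕ ↪ K → Tree K ↪ K
      infinite⇒tree↪ e with zorn TreeInjection treeInjection-chainClosed
      ... | M , M-max with ↪-total (Extension.Complement (proj₁ M-max)) (TreeInjection.X (proj₁ M-max))
      ...   | inj₁ i = Extension.tree↪-absorbing (proj₁ M-max) i
      ...   | inj₂ j =
        let x , x∈X = maximal⇒nonempty M-max e
        in contradiction M-max
             (Extension.extendable (proj₁ M-max) j (x , χ-intro (Dom M ∘ leaf) x∈X))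

-- The reaping family and its size

module _ (em : ∀ {ℓ} → ExcludedMiddle ℓ) (ac : AxiomOfChoice 0ℓ 0ℓ 0ℓ 0ℓ 0ℓ)
         {𝒜 : Family} (𝒜-max : IsMaximalDIndependent 𝒜) where
  open Classical em
  open WithChoice ac
  open IsDIndependent (proj₁ 𝒜-max) using (nonempty)

  infinitePart : Family
  infinitePart = record
    { Mem  = λ B → B ∈ ⟨ 𝒜 ⟩ × Infinite B
    ; resp = λ A≗B (A∈ , A-inf) → ext A≗B A∈ , λ m →
        let n , m≤n , n∈A = A-inf m in n , m≤n , trans (sym (A≗B n)) n∈A
    }

  infinite-or-finite : ∀ B → Infinite B ⊎ ∃[ m ] ∀ n → m ℕ.≤ n → B n ≡ false
  infinite-or-finite B = all-or-counterexample λ m → unbounded-or-bounded m em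
    where
    unbounded-or-bounded : ∀ m → Dec (∃[ n ] m ℕ.≤ n × B n ≡ true) →
      (∃[ n ] m ℕ.≤ n × B n ≡ true) ⊎ (∀ n → m ℕ.≤ n → B n ≡ false)
    unbounded-or-bounded m (yes p) = inj₁ p
    unbounded-or-bounded m (no ∄)  = inj₂ λ n m≤n → ¬-not λ n∈B → ∄ (n , m≤n , n∈B)

  -- A bisecting S halves the infinite members of ⟨𝒜⟩; the finite ones are halved by any set.
  infinitePart-isHalfReaping : IsHalfReaping infinitePart
  infinitePart-isHalfReaping = record
    { all-infinite = proj₂
    ; unbisected   = λ (S , _ , bisects) → halved⇒¬maximal (proj₁ 𝒜-max)
        (λ {B} B∈ → [ (λ B-inf → bisects⇒halfOn (bisects (B∈ , B-inf)))
                    , (λ (_ , B-fin) → halfOn-finite B-fin) ]′ (infinite-or-finite B))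
        𝒜-max
    }

  private
    module 𝒜 = Setoid ∣ 𝒜 ∣

    repᴬ : 𝒜.Carrier → 𝒜.Carrier
    repᴬ = proj₁ (canonical ac ∣ 𝒜 ∣)

    ≈repᴬ : ∀ a → a 𝒜.≈ repᴬ a
    ≈repᴬ = proj₁ (proj₂ (canonical ac ∣ 𝒜 ∣))

    repᴬ-cong : ∀ {a b} → a 𝒜.≈ b → repᴬ a ≡ repᴬ b
    repᴬ-cong = proj₂ (proj₂ (canonical ac ∣ 𝒜 ∣))

    -- Choosing representatives replaces ≗ by propositional equality.
    K : Set
    K = ∃[ a ] repᴬ a ≡ a

    set : K → 𝒫ω
    set ((A , _) , _) = A

    set-injective : ∀ {k l} → set k ≗ set l → k ≡ l
    set-injective {a , p} {b , q} eq with trans (sym p) (trans (repᴬ-cong {a} {b} eq) q)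
    ... | refl = cong (a ,_) (uip p q)

    toK : 𝒜.Carrier → K
    toK a = repᴬ a , repᴬ-cong (𝒜.sym {a} {repᴬ a} (≈repᴬ a))

    listed : ∀ {A k ks} → set k ≗ A → Any (k ≡_) ks → A ∈ Mem (fromList (List.map set ks))
    listed k≗A (here refl) = inj₂ k≗A
    listed k≗A (there k∈)  = inj₁ (listed k≗A k∈)

    -- A list exhausting K would make 𝒜 finite.
    fresh : ∀ ks → ∃[ k ] ¬ Any (k ≡_) ks
    fresh ks with all-or-counterexample (λ k → excludedMiddle (Any (k ≡_) ks))
    ... | inj₂ k∉ = k∉
    ... | inj₁ all = contradiction
      (λ {A} A∈ → listed (λ n → sym (≈repᴬ (A , A∈) n)) (all (toK (A , A∈))))
      (maximal⇒¬finite 𝒜-max (List.map set ks))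

    tree↪K : Tree K ↪ K
    tree↪K = infinite⇒tree↪ (fresh⇒ℕ↪ fresh)

    eval : Tree K → 𝒫ω
    eval (leaf k)   = set k
    eval (node s t) = ∁ (eval s ∩ eval t)

    eval-surjective : ∀ {B} → B ∈ ⟨ 𝒜 ⟩ → ∃[ t ] eval t ≗ B
    eval-surjective (gen {A} A∈) = leaf (toK (A , A∈)) , λ n → sym (≈repᴬ (A , A∈) n)
    eval-surjective whole =
      -- For any t, the NAND of t with its complement is ω; nonemptiness of 𝒜 provides a leaf.
      let t = leaf (toK nonempty) in node t (node t t) , λ n → excluded (eval t n)
      where
      excluded : ∀ b → not (b ∧ not (b ∧ b)) ≡ true
      excluded true  = refl
      excluded false = refl
    eval-surjective (compl B∈) =
      let t , t≗ = eval-surjective B∈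
      in node t t , λ n → cong not (trans (∧-idem (eval t n)) (t≗ n))
    eval-surjective (inter B∈ C∈) =
      let s , s≗ = eval-surjective B∈
          t , t≗ = eval-surjective C∈
      in node (node s t) (node s t) , λ n →
         trans (cong not (∧-idem _)) (trans (not-involutive _) (cong₂ _∧_ (s≗ n) (t≗ n)))
    eval-surjective (ext B≗C B∈) =
      let t , t≗ = eval-surjective B∈ in t , λ n → trans (t≗ n) (B≗C n)

  -- A set goes to a tree that evaluates to it, and the tree to an element of K. The tree depends on
  -- the membership proof, so representatives are taken first.
  infinitePart-≤ᶜ : ∣ infinitePart ∣ ≤ᶜ ∣ 𝒜 ∣
  infinitePart-≤ᶜ = record
    { to        = λ x → proj₁ (proj₁ tree↪K (term (rep x)))
    ; cong      = λ {x} {y} x≈y n →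
        cong (λ z → set (proj₁ tree↪K (term z)) n) (rep-cong {x} {y} x≈y)
    ; injective = λ {x} {y} eq →
        let rep-eq : rep x ℛ.≈ rep y
            rep-eq = term-injective {rep x} {rep y} (proj₂ tree↪K (set-injective eq))
        in ℛ.trans {x} {rep x} {y} (≈rep x) (ℛ.trans {rep x} {rep y} {y} rep-eq
             (ℛ.sym {y} {rep y} (≈rep y)))
    }
    where
    module ℛ = Setoid ∣ infinitePart ∣
    reps = canonical ac ∣ infinitePart ∣
    rep = proj₁ reps
    ≈rep = proj₁ (proj₂ reps)
    rep-cong = proj₂ (proj₂ reps)
    term : ℛ.Carrier → Tree K
    term (_ , B∈ , _) = proj₁ (eval-surjective B∈)
    term-injective : ∀ {x y} → term x ≡ term y → x ℛ.≈ y
    term-injective {_ , B∈ , _} {_ , C∈ , _} eq n =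
      trans (sym (proj₂ (eval-surjective B∈) n))
        (trans (cong (λ t → eval t n) eq) (proj₂ (eval-surjective C∈) n))

theorem2p3 : (∀ {ℓ} → ExcludedMiddle ℓ) →
    (∀ {a ℓ₁ b ℓ₂ r} → AxiomOfChoice a ℓ₁ b ℓ₂ r) →
    (𝔯½ 𝔦d : Setoid 0ℓ 0ℓ) → Is-𝔯½ 𝔯½ → Is-𝔦d 𝔦d → 𝔯½ ≤ᶜ 𝔦d
theorem2p3 em ac 𝔯½ 𝔦d 𝔯-least 𝔦-least =
  let 𝒜 , 𝒜-max , 𝔦d≅𝒜 = attained 𝔦-least
  -- The chain is 𝔯½ ≤ infinite part of ⟨𝒜⟩ ≤ 𝒜 ≤ 𝔦d, ending with the inverse of the bijection that
  -- attains 𝔦d.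
  in injection (least 𝔯-least (infinitePart em ac 𝒜-max) (infinitePart-isHalfReaping em ac 𝒜-max))
       (injection (infinitePart-≤ᶜ em ac 𝒜-max)
         (Inverse⇒Injection (Inverse-sym (Bijection⇒Inverse 𝔦d≅𝒜))))
  where open IsLeastCardinality
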